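{- Let $k\geq 2$ be an integer and let $G_l(q)$, $l\geq 1$, be the sequence of formal series defined in the context. Then for every $j\geq 0$ and every $i\in\{1,\dots,k\}$, $$G_{(k-1)j+i}(q)=\frac{1}{F(q)}\sum_{n\geq 0}\frac{(-1)^n q^{4k\binom{n}{2}+(2k(j+1)+2i-1)n}\prod_{t=1}^{j}\bigl(1-q^{2(n+t)}\bigr)}{\prod_{t=0}^{j}\bigl(1+q^{2(n+t)+1}\bigr)}\cdot\Bigl(1-q^{2(k-i+1)(2n+j+1)}+q^{2(n+j)+1}\bigl(1-q^{2(k-i)(2n+j+1)}\bigr)\Bigr),$$ where each factor $(1+q^{a})^{ -1}$ is expanded as a formal power series in $q$ and the empty product (for $j=0$) equals $1$.
   Context: $q$ is a formal variable and all series are formal (Laurent) series in $q$. Fix an integer $k\geq 2$. Let $F(q)=\prod_{m\geq 1,\ m\not\equiv 2 \pmod 4}(1-q^m)$. For $1\leq i\leq k$ define $$G_i(q)=\prod_{\substack{m\geq 1,\ m\not\equiv 2\ (\mathrm{mod}\ 4),\\ m\not\equiv 0,\ 2k+(2i-1),\ 2k-(2i-1)\ (\mathrm{mod}\ 4k)}}(1-q^m)^{ -1}.$$ Every integer $l\geq k+1$ can be written uniquely as $l=(k-1)j+i$ with $j\geq 1$ and $2\leq i\leq k$ (note that $(k-1)j+1=(k-1)(j-1)+k$, so the indices $(k-1)j+1,\dots,(k-1)j+k$, the "$j$-th shelf", overlap consecutive shelves in one index). For such $l$ define recursively $$G_{(k-1)j+i}(q)=\frac{G_{(k-1)(j-1)+k-i+1}(q)-G_{(k-1)(j-1)+k-i+2}(q)}{q^{2j(i-1)}}-q^{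 -1}G_{(k-1)j+i-1}(q),$$ the right-hand side involving only indices smaller than $(k-1)j+i$. -}

module Defs where

open import Data.Nat as ℕ using (ℕ; zero; suc; _∸_; _≡ᵇ_; _≤ᵇ_)
open import Data.Nat.Combinatorics using (_C_)
open import Data.Integer as ℤ using (ℤ; +_; -[1+_])
open import Data.Bool using (Bool; true; false; if_then_else_; _∧_; not)
open import Data.List using (List; []; _∷_; map; foldr; upTo)

-- Formal power series in q with integer coefficients: n ↦ coeff of q^n
PS : Set
PS = ℕ → ℤ

-- Formal Laurent series (coefficient of q^z for every integer z).
-- Only subtraction and shifts are needed on these.
Laurent : Set
Laurent = ℤ → ℤ

sumTo : (ℕ → ℤ) → ℕ → ℤ
sumTo f zero = f 0
sumTo f (suc n) = sumTo f n ℤ.+ f (suc n)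

oneₚ : PS
oneₚ zero = + 1
oneₚ (suc _) = + 0

mono : ℕ → PS
mono e n = if e ≡ᵇ n then + 1 else + 0

_+ₚ_ : PS → PS → PS
(f +ₚ g) n = f n ℤ.+ g n

_-ₚ_ : PS → PS → PS
(f -ₚ g) n = f n ℤ.- g n

negₚ : PS → PS
negₚ f n = ℤ.- f n

scaleₚ : ℤ → PS → PS
scaleₚ c f n = c ℤ.* f n

_*ₚ_ : PS → PS → PS
(f *ₚ g) n = sumTo (λ a → f a ℤ.* g (n ∸ a)) n

powₚ : PS → ℕ → PS
powₚ f zero = oneₚ
powₚ f (suc t) = powₚ f t *ₚ f

-- (1 - c)^{-1} = Σ_{t≥0} c^t, for c with zero constant term
-- (then c^t has order ≥ t, so coefficient n only needs t ≤ n).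
geom : PS → PS
geom c n = sumTo (λ t → powₚ c t n) n

prodList : List PS → PS
prodList = foldr _*ₚ_ oneₚ

prodRange : (ℕ → PS) → ℕ → ℕ → PS
prodRange f a len = prodList (map (λ t → f (a ℕ.+ t)) (upTo len))

-- Infinite product ∏_{m≥1} P m, where each P m ≡ 1 (mod q^m):
-- the coefficient of q^N only depends on the factors with m ≤ N.
infProd : (ℕ → PS) → PS
infProd P N = prodRange P 1 N N

-- Infinite sum Σ_{n≥0} T n, where T n has order ≥ n:
-- the coefficient of q^N only depends on the terms with n ≤ N.
infSum : (ℕ → PS) → PS
infSum T N = sumTo (λ n → T n N) N

sgn : ℕ → ℤ
sgn zero = + 1
sgn (suc n) = ℤ.- sgn n

-- modular arithmetic helpers (modulus 0 never occurs for k ≥ 2)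
modN : ℕ → ℕ → ℕ
modN m zero = m
modN m (suc n) = m ℕ.% suc n

divN : ℕ → ℕ → ℕ
divN m zero = zero
divN m (suc n) = m ℕ./ suc n

F : PS
F = infProd (λ m → if not (modN m 4 ≡ᵇ 2) then oneₚ -ₚ mono m else oneₚ)

invF : PS
invF = geom (oneₚ -ₚ F)

-- membership condition for the product defining G_i
-- (m ≢ 2 mod 4, and m ≢ 0, 2k+(2i-1), 2k-(2i-1) mod 4k;
--  for 1 ≤ i ≤ k, 2k-(2i-1) ≥ 1 so natural subtraction is exact)
inG : ℕ → ℕ → ℕ → Bool
inG k i m =
  not (modN m 4 ≡ᵇ 2) ∧
  (not (r ≡ᵇ 0) ∧
  (not (r ≡ᵇ modN (2 ℕ.* k ℕ.+ (2 ℕ.* i ∸ 1)) (4 ℕ.* k)) ∧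
   not (r ≡ᵇ modN (2 ℕ.* k ∸ (2 ℕ.* i ∸ 1)) (4 ℕ.* k))))
  where r = modN m (4 ℕ.* k)

Gbase : ℕ → ℕ → PS
Gbase k i = infProd (λ m → if inG k i m then geom (mono m) else oneₚ)

toL : PS → Laurent
toL f (+ n) = f n
toL f -[1+ n ] = + 0

_-L_ : Laurent → Laurent → Laurent
(f -L g) z = f z ℤ.- g z

divq : ℕ → Laurent → Laurent
divq a f z = f (z ℤ.+ + a)

-- shelf k j i = G_{(k-1)j+i}(q), for j ≥ 0, 1 ≤ i ≤ k
shelf : ℕ → ℕ → ℕ → Laurent
shelf k zero i = toL (Gbase k i)
shelf k (suc j) i = row i
  where
  row : ℕ → Laurent
  row zero = λ _ → + 0   -- unused (i ≥ 1)
  row (suc zero) = shelf k j k   -- G_{(k-1)(j+1)+1} = G_{(k-1)j+k}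
  row (suc (suc i')) =
    divq (2 ℕ.* suc j ℕ.* suc i')
         (shelf k j (k ∸ suc (suc i') ℕ.+ 1) -L shelf k j (k ∸ suc (suc i') ℕ.+ 2))
    -L divq 1 (row (suc i'))

-- G_l(q) for l ≥ 1: l ≤ k is the product definition; for l ≥ k+1,
-- l = (k-1)j + i with j ≥ 1, 2 ≤ i ≤ k, i.e. j = (l-2) div (k-1),
-- i = (l-2) mod (k-1) + 2.
G : ℕ → ℕ → Laurent
G k l = if l ≤ᵇ k then shelf k 0 l
        else shelf k (divN (l ∸ 2) (k ∸ 1)) (modN (l ∸ 2) (k ∸ 1) ℕ.+ 2)

term : ℕ → ℕ → ℕ → ℕ → PS
term k j i n =
  scaleₚ (sgn n)
    (mono (4 ℕ.* k ℕ.* (n C 2) ℕ.+ (2 ℕ.* k ℕ.* (j ℕ.+ 1) ℕ.+ 2 ℕ.* i ∸ 1) ℕ.* n)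
     *ₚ (prodRange (λ t → oneₚ -ₚ mono (2 ℕ.* (n ℕ.+ t))) 1 j
     *ₚ (prodRange (λ t → geom (negₚ (mono (2 ℕ.* (n ℕ.+ t) ℕ.+ 1)))) 0 (suc j)
     *ₚ bracket)))
  where
  bracket : PS
  bracket = (oneₚ -ₚ mono (2 ℕ.* (k ∸ i ℕ.+ 1) ℕ.* (2 ℕ.* n ℕ.+ j ℕ.+ 1)))
            +ₚ (mono (2 ℕ.* (n ℕ.+ j) ℕ.+ 1)
                *ₚ (oneₚ -ₚ mono (2 ℕ.* (k ∸ i) ℕ.* (2 ℕ.* n ℕ.+ j ℕ.+ 1))))

RHS : ℕ → ℕ → ℕ → PS
RHS k j i = invF *ₚ infSum (term k j i)

{-# OPTIONS --safe #-}

-- Idea.  Write H(j,i) for F times the right-hand side.  For j = 0 the bracket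
-- divided by 1 + q^(2n+1) leaves two monomials, and the sum is the theta series
-- of Jacobi's triple product with base q^d, d = 4k, and offsets b = 2k + 2i - 1,
-- c = 2k - 2i + 1 (b + c = d), which is F G_i.  The triple product comes from
-- Cauchy's q-binomial theorem for ∏_{m < 2s} (q^(ds) - q^(b + dm)): the factors
-- with m < s give the offset c, those with m ≥ s the offset b, and modulo
-- q^(s+1) the q-binomial coefficients cancel against ∏_{m ≤ s} (1 - q^(dm)).
--
-- For the step, with k = i + r, the n-th terms T satisfy
--   T(j,r+1,n) - T(j,r+2,n) = U n + W n,
--   q^a T(j+1,i,n) + q^(a-1) T(j+1,i-1,n) = U n + W (n+1),   a = 2(j+1)(i-1),
-- where W 0 = 0 because W n contains the factor 1 - q^(2n), so both sums agree.
-- H(j+1,1) = H(j,k) follows in the same way.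
module Submission where

open import Defs
open import Algebra.Bundles using (CommutativeMonoid; CommutativeRing; RawRing)
import Algebra.Properties.CommutativeSemigroup as CommutativeSemigroupProperties
import Algebra.Properties.Ring as RingProperties
import Algebra.Solver.Ring as RingSolver
open import Algebra.Solver.Ring.AlmostCommutativeRing using (fromCommutativeRing; _-Raw-AlmostCommutative⟶_)
open import Algebra.Structures using (IsCommutativeRing)
open import Data.Bool using (true; false; if_then_else_; _∧_; not; T)
open import Data.Empty using (⊥; ⊥-elim)
import Data.Fin as Fin
open import Data.Integer as ℤ using (ℤ; +_; -[1+_])
import Data.Integer.Properties as ℤₚ
open import Data.List using (map; applyUpTo)
open import Data.Maybe using (Maybe; just; nothing)
open import Data.Nat as ℕ using (ℕ; zero; suc; _≤_; _<_; z≤n; s≤s; _∸_; _%_; _/_; _≡ᵇ_; _≤ᵇ_)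
open import Data.Nat.Combinatorics using (_C_; nC1≡n; nCk+nC[k+1]≡[n+1]C[k+1])
open import Data.Nat.Divisibility using (divides; m∣m*n)
open import Data.Nat.DivMod using (m<n⇒m%n≡m; n%n≡0; [m+kn]%n≡m%n; m∣n⇒o%n%m≡o%m; m<n⇒m/n≡0; m*n/n≡m; +-distrib-/-∣ʳ)
import Data.Nat.Properties as ℕₚ
open import Data.Nat.Tactic.RingSolver using (solve-∀)
open import Data.Product using (_×_; _,_)
open import Data.Sum using (_⊎_; inj₁; inj₂)
open import Function using (_∘_)
open import Level using (0ℓ)
open import Relation.Binary.Bundles using (Setoid)
open import Relation.Binary.PropositionalEquality as ≡ using (_≡_; _≢_; refl; sym; trans; cong; cong₂; subst; module ≡-Reasoning)
import Relation.Binary.Reasoning.Setoid as SetoidReasoning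
open import Relation.Nullary using (yes; no; contradiction; ¬_)

-- The ring of power series

-- `infSum` and `infProd` cut every coefficient off at its own place, so they cannot be rearranged
-- as wholes. Each identity between them is therefore proved modulo q^K for finite sums or products
-- of one common length, with K arbitrary. Division is avoided: F is moved to the other side, the
-- recursion is multiplied by its largest power of q, and q-binomial coefficients are given by
-- Pascal's rule. Negative powers of q occur only at the very end, where power series are embedded
-- in Laurent series. The splitting into U and W comes from the products in a term. Those of shelf j
-- + 1 at n run over a window of consecutive factors that contains the windows of shelf j at n and
-- at n + 1; the brackets supply the end factors in which the windows differ. Since the recursion
-- reflects the index i to k - i + 1, a term is parametrised by both i and its distance r from k,
-- and reflection nearly exchanges the two.

infix 4 _≈_

record _≈_ (f g : PS) : Set where
  constructor mk
  field coeff : ∀ n → f n ≡ g n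
open _≈_

sumTo-cong : ∀ {f g} n → (∀ a → a ≤ n → f a ≡ g a) → sumTo f n ≡ sumTo g n
sumTo-cong zero h = h 0 z≤n
sumTo-cong (suc n) h = cong₂ ℤ._+_ (sumTo-cong n (λ a p → h a (ℕₚ.m≤n⇒m≤1+n p))) (h (suc n) ℕₚ.≤-refl)

sumTo-front : ∀ f n → sumTo f (suc n) ≡ f 0 ℤ.+ sumTo (λ a → f (suc a)) n
sumTo-front f zero = refl
sumTo-front f (suc n) = trans (cong (ℤ._+ f (suc (suc n))) (sumTo-front f n)) (ℤₚ.+-assoc (f 0) _ _)

+-interchange : ∀ a b c d → (a ℤ.+ b) ℤ.+ (c ℤ.+ d) ≡ (a ℤ.+ c) ℤ.+ (b ℤ.+ d)
+-interchange a b c d = begin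
  (a ℤ.+ b) ℤ.+ (c ℤ.+ d) ≡⟨ ℤₚ.+-assoc a b _ ⟩
  a ℤ.+ (b ℤ.+ (c ℤ.+ d)) ≡⟨ cong (λ x → a ℤ.+ x) (sym (ℤₚ.+-assoc b c d)) ⟩
  a ℤ.+ ((b ℤ.+ c) ℤ.+ d) ≡⟨ cong (λ x → a ℤ.+ (x ℤ.+ d)) (ℤₚ.+-comm b c) ⟩
  a ℤ.+ ((c ℤ.+ b) ℤ.+ d) ≡⟨ cong (λ x → a ℤ.+ x) (ℤₚ.+-assoc c b d) ⟩
  a ℤ.+ (c ℤ.+ (b ℤ.+ d)) ≡⟨ sym (ℤₚ.+-assoc a c _) ⟩
  (a ℤ.+ c) ℤ.+ (b ℤ.+ d) ∎
  where open ≡-Reasoning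

sumTo-+ : ∀ f g n → sumTo (λ a → f a ℤ.+ g a) n ≡ sumTo f n ℤ.+ sumTo g n
sumTo-+ f g zero = refl
sumTo-+ f g (suc n) = trans (cong (λ x → x ℤ.+ (f (suc n) ℤ.+ g (suc n))) (sumTo-+ f g n)) (+-interchange (sumTo f n) (sumTo g n) _ _)

sumTo-* : ∀ c f n → sumTo (λ a → c ℤ.* f a) n ≡ c ℤ.* sumTo f n
sumTo-* c f zero = refl
sumTo-* c f (suc n) = trans (cong (λ x → x ℤ.+ c ℤ.* f (suc n)) (sumTo-* c f n)) (sym (ℤₚ.*-distribˡ-+ c _ _))

tail : PS → PS
tail f n = f (suc n)

*ₚ-front : ∀ f g n → (f *ₚ g) (suc n) ≡ f 0 ℤ.* g (suc n) ℤ.+ (tail f *ₚ g) n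
*ₚ-front f g n = sumTo-front (λ a → f a ℤ.* g (suc n ∸ a)) n

*ₚ-back : ∀ f g n → (f *ₚ g) (suc n) ≡ (f *ₚ tail g) n ℤ.+ f (suc n) ℤ.* g 0
*ₚ-back f g n = cong₂ ℤ._+_
  (sumTo-cong n (λ a a≤n → cong (λ x → f a ℤ.* g x) (ℕₚ.+-∸-assoc 1 a≤n)))
  (cong (λ x → f (suc n) ℤ.* g x) (ℕₚ.n∸n≡0 (suc n)))

-- The coefficient 0 of `f` is peeled off at the front of one product and at the back of the other,
-- which leaves `tail f` on both sides; no reindexing of the convolution is needed.
*ₚ-comm-at : ∀ n f g → (f *ₚ g) n ≡ (g *ₚ f) n
*ₚ-comm-at zero f g = ℤₚ.*-comm (f 0) (g 0)
*ₚ-comm-at (suc n) f g = begin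
  (f *ₚ g) (suc n)                           ≡⟨ *ₚ-front f g n ⟩
  f 0 ℤ.* g (suc n) ℤ.+ (tail f *ₚ g) n      ≡⟨ cong₂ ℤ._+_ (ℤₚ.*-comm (f 0) _) (*ₚ-comm-at n (tail f) g) ⟩
  g (suc n) ℤ.* f 0 ℤ.+ (g *ₚ tail f) n      ≡⟨ ℤₚ.+-comm (g (suc n) ℤ.* f 0) ((g *ₚ tail f) n) ⟩
  (g *ₚ tail f) n ℤ.+ g (suc n) ℤ.* f 0      ≡⟨ sym (*ₚ-back g f n) ⟩
  (g *ₚ f) (suc n)                           ∎
  where open ≡-Reasoning

*ₚ-cong-≤ : ∀ {f f′ g g′} n → (∀ a → a ≤ n → f a ≡ f′ a) → (∀ a → a ≤ n → g a ≡ g′ a) →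
            (f *ₚ g) n ≡ (f′ *ₚ g′) n
*ₚ-cong-≤ n p r = sumTo-cong n (λ a a≤n → cong₂ ℤ._*_ (p a a≤n) (r (n ∸ a) (ℕₚ.m∸n≤m n a)))

*ₚ-distribʳ-at : ∀ n f g h → ((f +ₚ g) *ₚ h) n ≡ (f *ₚ h) n ℤ.+ (g *ₚ h) n
*ₚ-distribʳ-at n f g h = trans
  (sumTo-cong n (λ a _ → ℤₚ.*-distribʳ-+ (h (n ∸ a)) (f a) (g a)))
  (sumTo-+ (λ a → f a ℤ.* h (n ∸ a)) (λ a → g a ℤ.* h (n ∸ a)) n)

scaleₚ-*ₚ-at : ∀ n c f g → (scaleₚ c f *ₚ g) n ≡ c ℤ.* (f *ₚ g) n
scaleₚ-*ₚ-at n c f g = trans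
  (sumTo-cong n (λ a _ → ℤₚ.*-assoc c (f a) (g (n ∸ a))))
  (sumTo-* c (λ a → f a ℤ.* g (n ∸ a)) n)

-- By `*ₚ-front`, the tail of `f *ₚ g` is f(0) times `tail g` plus `tail f *ₚ g`, so the induction
-- on the coefficient only has to treat `tail f`.
*ₚ-assoc-at : ∀ n f g h → ((f *ₚ g) *ₚ h) n ≡ (f *ₚ (g *ₚ h)) n
*ₚ-assoc-at zero f g h = ℤₚ.*-assoc (f 0) (g 0) (h 0)
*ₚ-assoc-at (suc n) f g h = begin
  ((f *ₚ g) *ₚ h) (suc n)
    ≡⟨ *ₚ-front (f *ₚ g) h n ⟩
  (f 0 ℤ.* g 0) ℤ.* h (suc n) ℤ.+ (tail (f *ₚ g) *ₚ h) n
    ≡⟨ cong (λ x → (f 0 ℤ.* g 0) ℤ.* h (suc n) ℤ.+ x) (begin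
       (tail (f *ₚ g) *ₚ h) n
         ≡⟨ *ₚ-cong-≤ {g = h} n (λ a _ → *ₚ-front f g a) (λ _ _ → refl) ⟩
       ((scaleₚ (f 0) (tail g) +ₚ (tail f *ₚ g)) *ₚ h) n
         ≡⟨ *ₚ-distribʳ-at n (scaleₚ (f 0) (tail g)) (tail f *ₚ g) h ⟩
       (scaleₚ (f 0) (tail g) *ₚ h) n ℤ.+ ((tail f *ₚ g) *ₚ h) n
         ≡⟨ cong₂ ℤ._+_ (scaleₚ-*ₚ-at n (f 0) (tail g) h) (*ₚ-assoc-at n (tail f) g h) ⟩
       f 0 ℤ.* (tail g *ₚ h) n ℤ.+ (tail f *ₚ (g *ₚ h)) n ∎) ⟩
  (f 0 ℤ.* g 0) ℤ.* h (suc n) ℤ.+ (f 0 ℤ.* (tail g *ₚ h) n ℤ.+ (tail f *ₚ (g *ₚ h)) n)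
    ≡⟨ sym (ℤₚ.+-assoc ((f 0 ℤ.* g 0) ℤ.* h (suc n)) _ _) ⟩
  ((f 0 ℤ.* g 0) ℤ.* h (suc n) ℤ.+ f 0 ℤ.* (tail g *ₚ h) n) ℤ.+ (tail f *ₚ (g *ₚ h)) n
    ≡⟨ cong (ℤ._+ (tail f *ₚ (g *ₚ h)) n) (trans
         (cong (ℤ._+ f 0 ℤ.* (tail g *ₚ h) n) (ℤₚ.*-assoc (f 0) (g 0) (h (suc n))))
         (sym (ℤₚ.*-distribˡ-+ (f 0) _ _))) ⟩
  f 0 ℤ.* (g 0 ℤ.* h (suc n) ℤ.+ (tail g *ₚ h) n) ℤ.+ (tail f *ₚ (g *ₚ h)) n
    ≡⟨ cong (λ x → f 0 ℤ.* x ℤ.+ (tail f *ₚ (g *ₚ h)) n) (sym (*ₚ-front g h n)) ⟩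
  f 0 ℤ.* (g *ₚ h) (suc n) ℤ.+ (tail f *ₚ (g *ₚ h)) n
    ≡⟨ sym (*ₚ-front f (g *ₚ h) n) ⟩
  (f *ₚ (g *ₚ h)) (suc n) ∎
  where open ≡-Reasoning

zeroₚ : PS
zeroₚ _ = + 0

*ₚ-zeroˡ-at : ∀ n f g → (∀ a → a ≤ n → f a ≡ + 0) → (f *ₚ g) n ≡ + 0
*ₚ-zeroˡ-at zero f g h = trans (cong (ℤ._* g 0) (h 0 z≤n)) (ℤₚ.*-zeroˡ (g 0))
*ₚ-zeroˡ-at (suc n) f g h = trans (*ₚ-front f g n) (cong₂ ℤ._+_
  (trans (cong (ℤ._* g (suc n)) (h 0 z≤n)) (ℤₚ.*-zeroˡ (g (suc n))))
  (*ₚ-zeroˡ-at n (tail f) g (λ a p → h (suc a) (s≤s p))))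

const : ℤ → PS
const c zero = c
const c (suc _) = + 0

const-*ₚ-at : ∀ n c g → (const c *ₚ g) n ≡ c ℤ.* g n
const-*ₚ-at zero c g = refl
const-*ₚ-at (suc n) c g = trans (*ₚ-front (const c) g n)
  (trans (cong (λ x → c ℤ.* g (suc n) ℤ.+ x) (*ₚ-zeroˡ-at n (tail (const c)) g (λ _ _ → refl)))
         (ℤₚ.+-identityʳ _))

oneₚ-const : ∀ n → oneₚ n ≡ const (+ 1) n
oneₚ-const zero = refl
oneₚ-const (suc n) = refl

*ₚ-identityˡ-at : ∀ n f → (oneₚ *ₚ f) n ≡ f n
*ₚ-identityˡ-at n f = trans (*ₚ-cong-≤ {g = f} n (λ a _ → oneₚ-const a) (λ _ _ → refl))
  (trans (const-*ₚ-at n (+ 1) f) (ℤₚ.*-identityˡ (f n)))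

infixl 6 _⊕_
infixl 7 _⊗_

-- Opaque copies of the operations: otherwise unification unfolds products into
-- their coefficients.
opaque
  _⊕_ : PS → PS → PS
  f ⊕ g = f +ₚ g

  _⊗_ : PS → PS → PS
  f ⊗ g = f *ₚ g

  neg : PS → PS
  neg f = negₚ f

  +ₚ≈⊕ : ∀ f g → f +ₚ g ≈ f ⊕ g
  +ₚ≈⊕ f g = mk λ _ → refl

  *ₚ≈⊗ : ∀ f g → f *ₚ g ≈ f ⊗ g
  *ₚ≈⊗ f g = mk λ _ → refl

  negₚ≈neg : ∀ f → negₚ f ≈ neg f
  negₚ≈neg f = mk λ _ → refl

  -ₚ≈⊕neg : ∀ f g → f -ₚ g ≈ f ⊕ neg g
  -ₚ≈⊕neg f g = mk λ _ → refl

  ⊕-isCommutativeRing : IsCommutativeRing _≈_ _⊕_ _⊗_ neg zeroₚ oneₚ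
  ⊕-isCommutativeRing = record
    { isRing = record
      { +-isAbelianGroup = record
        { isGroup = record
          { isMonoid = record
            { isSemigroup = record
              { isMagma = record
                { isEquivalence = record
                  { refl = mk λ _ → refl
                  ; sym = λ p → mk λ n → sym (coeff p n)
                  ; trans = λ p r → mk λ n → trans (coeff p n) (coeff r n) }
                ; ∙-cong = λ p r → mk λ n → cong₂ ℤ._+_ (coeff p n) (coeff r n) }
              ; assoc = λ f g h → mk λ n → ℤₚ.+-assoc (f n) (g n) (h n) }
            ; identity = (λ f → mk λ n → ℤₚ.+-identityˡ (f n)) , (λ f → mk λ n → ℤₚ.+-identityʳ (f n)) }
          ; inverse = (λ f → mk λ n → ℤₚ.+-inverseˡ (f n)) , (λ f → mk λ n → ℤₚ.+-inverseʳ (f n))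
          ; ⁻¹-cong = λ p → mk λ n → cong ℤ.-_ (coeff p n) }
        ; comm = λ f g → mk λ n → ℤₚ.+-comm (f n) (g n) }
      ; *-cong = λ p r → mk λ n → *ₚ-cong-≤ n (λ a _ → coeff p a) (λ a _ → coeff r a)
      ; *-assoc = λ f g h → mk λ n → *ₚ-assoc-at n f g h
      ; *-identity = (λ f → mk λ n → *ₚ-identityˡ-at n f)
                   , (λ f → mk λ n → trans (*ₚ-comm-at n f oneₚ) (*ₚ-identityˡ-at n f))
      ; distrib = (λ f g h → mk λ n → trans (*ₚ-comm-at n f (g +ₚ h)) (trans (*ₚ-distribʳ-at n g h f)
                     (cong₂ ℤ._+_ (*ₚ-comm-at n g f) (*ₚ-comm-at n h f))))
                , (λ h f g → mk λ n → *ₚ-distribʳ-at n f g h)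
      }
    ; *-comm = λ f g → mk λ n → *ₚ-comm-at n f g }

PSRing : CommutativeRing 0ℓ 0ℓ
PSRing = record { isCommutativeRing = ⊕-isCommutativeRing }

ℤRaw : RawRing 0ℓ 0ℓ
ℤRaw = record { Carrier = ℤ ; _≈_ = _≡_ ; _+_ = ℤ._+_ ; _*_ = ℤ._*_ ; -_ = ℤ.-_ ; 0# = + 0 ; 1# = + 1 }

opaque
  unfolding _⊕_
  ℤ→PS : ℤRaw -Raw-AlmostCommutative⟶ fromCommutativeRing PSRing
  ℤ→PS = record
    { ⟦_⟧ = const
    ; +-homo = λ c d → mk λ { zero → refl ; (suc n) → refl }
    ; *-homo = λ c d → mk λ { zero → refl
                            ; (suc n) → sym (trans (const-*ₚ-at (suc n) c (const d)) (ℤₚ.*-zeroʳ c)) }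
    ; -‿homo = λ c → mk λ { zero → refl ; (suc n) → refl }
    ; 0-homo = mk λ { zero → refl ; (suc n) → refl }
    ; 1-homo = mk λ n → sym (oneₚ-const n) }

-- Polynomial identities over an arbitrary commutative ring

module RingIdentities (R : CommutativeRing 0ℓ 0ℓ)
                      (φ : ℤRaw -Raw-AlmostCommutative⟶ fromCommutativeRing R) where
  open CommutativeRing R using (Carrier; 1#; _+_; _*_; _-_; -_) renaming (_≈_ to _≈ᴿ_)
  module ≈R = CommutativeRing R
  open _-Raw-AlmostCommutative⟶_ φ using (⟦_⟧)

  coeff≟ : ∀ c d → Maybe (⟦ c ⟧ ≈ᴿ ⟦ d ⟧)
  coeff≟ c d with c ℤ.≟ d
  ... | yes refl = just ≈R.refl
  ... | no _ = nothing

  open RingSolver ℤRaw (fromCommutativeRing R) φ coeff≟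

  -- A zeroth power denotes `1#` itself, whereas a constant polynomial would denote the image of 1
  -- under `φ`, which equals `1#` only up to `_≈ᴿ_`.
  𝟙 : ∀ {n} → Polynomial (suc n)
  𝟙 = var Fin.zero :^ 0

  -- To be used with X = q^(2n), Y = q^(2(n+j)+1), Z = q. The right-hand side is shaped for the next
  -- shelf: `1# - Y * Z` is the numerator factor that shelf j + 1 adds at n, and `1# - X` the one
  -- that it adds at n - 1.
  step-lhs : ∀ m A D Y X Z →
    (m * A * (1# - D * (Y * X * Z) * (Y * X * Z) + Y * (1# - D * (Y * X * Z))))
      - (m * (A * X) * (1# - D * (Y * X * Z) + Y * (1# - D)))
    ≈ᴿ m * (A * D * Y * X) * ((1# - Y * Z) * (1# + X * Z)) + m * A * ((1# - X) * (1# + Y))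
  step-lhs = solve 6 (λ m A D Y X Z →
    (m :* A :* (𝟙 :- D :* (Y :* X :* Z) :* (Y :* X :* Z) :+ Y :* (𝟙 :- D :* (Y :* X :* Z))))
      :- (m :* (A :* X) :* (𝟙 :- D :* (Y :* X :* Z) :+ Y :* (𝟙 :- D)))
    := m :* (A :* D :* Y :* X) :* ((𝟙 :- Y :* Z) :* (𝟙 :+ X :* Z)) :+ m :* A :* ((𝟙 :- X) :* (𝟙 :+ Y))) ≈R.refl

  -- The sum factors because `Y * X * Z * Z * Z` is the product of `X * Z` and `Y * Z * Z`. The
  -- resulting `1# + Y * Z * Z` matches the last denominator factor of shelf j + 1.
  step-rhs : ∀ m B Y X Z V →
    m * (B * (X * Z)) * ((1# - V * (Y * X * Z * Z * Z)) + Y * Z * Z * (1# - V))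
      + m * B * ((1# - V * (Y * X * Z * Z * Z) * (Y * X * Z * Z * Z)) + Y * Z * Z * (1# - V * (Y * X * Z * Z * Z)))
    ≈ᴿ m * B * (1# + X * Z) * (1# - V * (Y * X * Z * Z * Z)) * (1# + Y * Z * Z)
  step-rhs = solve 6 (λ m B Y X Z V →
    m :* (B :* (X :* Z)) :* ((𝟙 :- V :* (Y :* X :* Z :* Z :* Z)) :+ Y :* Z :* Z :* (𝟙 :- V))
      :+ m :* B :* ((𝟙 :- V :* (Y :* X :* Z :* Z :* Z) :* (Y :* X :* Z :* Z :* Z)) :+ Y :* Z :* Z :* (𝟙 :- V :* (Y :* X :* Z :* Z :* Z)))
    := m :* B :* (𝟙 :+ X :* Z) :* (𝟙 :- V :* (Y :* X :* Z :* Z :* Z)) :* (𝟙 :+ Y :* Z :* Z)) ≈R.refl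

  -- The two parts of `1# - v` belong to different n. With `1#`, `g` cancels `u₃` and the products
  -- at n remain; with `- v`, `P * u₁` and `u₂ * (Q * g)` reassemble into the products at n + 1, and
  -- `u₃` stays as a factor of W there.
  step-next : ∀ s P Q g B v u₁ u₂ u₃ Pₙ Qₙ x →
    Pₙ * x ≈ᴿ P * u₁ → Qₙ ≈ᴿ u₂ * (Q * g) → g * u₃ ≈ᴿ 1# →
    s * (P * u₁ * (Q * g)) * B * u₂ * (1# - v) * u₃
    ≈ᴿ s * (P * Q) * B * (u₁ * u₂) + - s * (Pₙ * Qₙ) * (B * v) * (x * u₃)
  step-next s P Q g B v u₁ u₂ u₃ Pₙ Qₙ x hP hQ hg = begin
    s * (P * u₁ * (Q * g)) * B * u₂ * (1# - v) * u₃
      ≈⟨ solve 9 (λ s P Q g B v u₁ u₂ u₃ →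
           s :* (P :* u₁ :* (Q :* g)) :* B :* u₂ :* (𝟙 :- v) :* u₃
           := s :* (P :* Q) :* B :* (u₁ :* u₂) :* (g :* u₃)
              :+ :- s :* ((P :* u₁) :* (u₂ :* (Q :* g))) :* (B :* v) :* u₃)
           ≈R.refl s P Q g B v u₁ u₂ u₃ ⟩
    s * (P * Q) * B * (u₁ * u₂) * (g * u₃) + - s * ((P * u₁) * (u₂ * (Q * g))) * (B * v) * u₃
      ≈⟨ ≈R.+-cong (≈R.trans (≈R.*-congˡ hg) (≈R.*-identityʳ _))
                   (≈R.*-congʳ (≈R.*-congʳ (≈R.*-congˡ (≈R.*-cong (≈R.sym hP) (≈R.sym hQ))))) ⟩
    s * (P * Q) * B * (u₁ * u₂) + - s * (Pₙ * x * Qₙ) * (B * v) * u₃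
      ≈⟨ ≈R.+-congˡ (solve 7 (λ s Pₙ x Qₙ B v u₃ →
           :- s :* (Pₙ :* x :* Qₙ) :* (B :* v) :* u₃ := :- s :* (Pₙ :* Qₙ) :* (B :* v) :* (x :* u₃))
           ≈R.refl s Pₙ x Qₙ B v u₃) ⟩
    s * (P * Q) * B * (u₁ * u₂) + - s * (Pₙ * Qₙ) * (B * v) * (x * u₃) ∎
    where open SetoidReasoning ≈R.setoid

  -- The bracket of the index k, where k - i = 0 reduces the second half to `Y * (1# - 1#)`.
  first-lhs : ∀ m A Y X Z →
    m * A * ((1# - Y * X * Z) + Y * (1# - 1#)) ≈ᴿ m * (A * X) * (1# - Y * Z) + m * A * (1# - X)
  first-lhs = solve 5 (λ m A Y X Z →
    m :* A :* ((𝟙 :- Y :* X :* Z) :+ Y :* (𝟙 :- 𝟙)) := m :* (A :* X) :* (𝟙 :- Y :* Z) :+ m :* A :* (𝟙 :- X)) ≈R.refl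

  first-next : ∀ s P Q g B Y X Z V u₁ Pₙ Qₙ x →
    Pₙ * x ≈ᴿ P * u₁ → Qₙ ≈ᴿ (1# + X * Z) * (Q * g) → g * (1# + Y * Z * Z) ≈ᴿ 1# →
    s * (P * u₁ * (Q * g)) * B * ((1# - V * (Y * X * Z * Z * Z)) + Y * Z * Z * (1# - V))
    ≈ᴿ s * (P * Q) * B * u₁ + - s * (Pₙ * Qₙ) * (B * V * Y * Z * Z) * x
  first-next s P Q g B Y X Z V u₁ Pₙ Qₙ x hP hQ hg = begin
    s * (P * u₁ * (Q * g)) * B * ((1# - V * (Y * X * Z * Z * Z)) + Y * Z * Z * (1# - V))
      ≈⟨ solve 10 (λ s P Q g B Y X Z V u₁ →
           s :* (P :* u₁ :* (Q :* g)) :* B :* ((𝟙 :- V :* (Y :* X :* Z :* Z :* Z)) :+ Y :* Z :* Z :* (𝟙 :- V))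
           := s :* (P :* Q) :* B :* u₁ :* (g :* (𝟙 :+ Y :* Z :* Z))
              :+ :- s :* ((P :* u₁) :* ((𝟙 :+ X :* Z) :* (Q :* g))) :* (B :* V :* Y :* Z :* Z))
           ≈R.refl s P Q g B Y X Z V u₁ ⟩
    s * (P * Q) * B * u₁ * (g * (1# + Y * Z * Z))
      + - s * ((P * u₁) * ((1# + X * Z) * (Q * g))) * (B * V * Y * Z * Z)
      ≈⟨ ≈R.+-cong (≈R.trans (≈R.*-congˡ hg) (≈R.*-identityʳ _))
                   (≈R.*-congʳ (≈R.*-congˡ (≈R.*-cong (≈R.sym hP) (≈R.sym hQ)))) ⟩
    s * (P * Q) * B * u₁ + - s * (Pₙ * x * Qₙ) * (B * V * Y * Z * Z)
      ≈⟨ ≈R.+-congˡ (solve 5 (λ s Pₙ x Qₙ b →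
           :- s :* (Pₙ :* x :* Qₙ) :* b := :- s :* (Pₙ :* Qₙ) :* b :* x) ≈R.refl s Pₙ x Qₙ _) ⟩
    s * (P * Q) * B * u₁ + - s * (Pₙ * Qₙ) * (B * V * Y * Z * Z) * x ∎
    where open SetoidReasoning ≈R.setoid

  reassociate : ∀ s e p q b → s * (e * (p * (q * b))) ≈ᴿ s * (p * q) * e * b
  reassociate = solve 5 (λ s e p q b → s :* (e :* (p :* (q :* b))) := s :* (p :* q) :* e :* b) ≈R.refl

  absorb : ∀ a m e b → a * (m * e * b) ≈ᴿ m * (a * e) * b
  absorb = solve 4 (λ a m e b → a :* (m :* e :* b) := m :* (a :* e) :* b) ≈R.refl

  shuffle : ∀ a u w v → a + (u + w) + v ≈ᴿ a + w + (u + v)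
  shuffle = solve 4 (λ a u w v → a :+ (u :+ w) :+ v := a :+ w :+ (u :+ v)) ≈R.refl

  swap-last : ∀ a b c → a + b + c ≈ᴿ a + c + b
  swap-last = solve 3 (λ a b c → a :+ b :+ c := a :+ c :+ b) ≈R.refl

  pascal-product : ∀ u v x y p q → (u * x + y) * (p * (1# - u) * (q * (1# - v)))
    ≈ᴿ u * (1# - v) * (x * (p * (1# - u) * q)) + (1# - u) * (y * (p * (q * (1# - v))))
  pascal-product = solve 6 (λ u v x y p q → (u :* x :+ y) :* (p :* (𝟙 :- u) :* (q :* (𝟙 :- v)))
    := u :* (𝟙 :- v) :* (x :* (p :* (𝟙 :- u) :* q)) :+ (𝟙 :- u) :* (y :* (p :* (q :* (𝟙 :- v))))) ≈R.refl

  pascal-sum : ∀ u v n → u * (1# - v) * n + (1# - u) * n ≈ᴿ n * (1# - u * v)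
  pascal-sum = solve 3 (λ u v n → u :* (𝟙 :- v) :* n :+ (𝟙 :- u) :* n := n :* (𝟙 :- u :* v)) ≈R.refl

  product-of-difference : ∀ x y → x * y - x ≈ᴿ - x * (1# - y)
  product-of-difference = solve 2 (λ x y → x :* y :- x := :- x :* (𝟙 :- y)) ≈R.refl

  difference-of-product : ∀ x y → x - x * y ≈ᴿ x * (1# - y)
  difference-of-product = solve 2 (λ x y → x :- x :* y := x :* (𝟙 :- y)) ≈R.refl

  -- The bracket is the product of `1# - v * y` and `1# + y`, and `g` inverts the second factor.
  theta-bracket : ∀ s e g y v → g * (1# + y) ≈ᴿ 1# →
    s * (1# * (1# * g)) * e * ((1# - v * (y * y)) + y * (1# - v)) ≈ᴿ s * e + - s * (e * (v * y))
  theta-bracket s e g y v hg = begin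
    s * (1# * (1# * g)) * e * ((1# - v * (y * y)) + y * (1# - v))
      ≈⟨ solve 5 (λ s e g y v → s :* (𝟙 :* (𝟙 :* g)) :* e :* ((𝟙 :- v :* (y :* y)) :+ y :* (𝟙 :- v))
           := (s :* e :+ :- s :* (e :* (v :* y))) :* (g :* (𝟙 :+ y))) ≈R.refl s e g y v ⟩
    (s * e + - s * (e * (v * y))) * (g * (1# + y))
      ≈⟨ ≈R.trans (≈R.*-congˡ hg) (≈R.*-identityʳ _) ⟩
    s * e + - s * (e * (v * y)) ∎
    where open SetoidReasoning ≈R.setoid

  pascal-term : ∀ s e f a b x y u v → u * x ≈ᴿ e * f * a → v * y ≈ᴿ e * b →
    - s * (e * (f * a + b)) ≈ᴿ u * (- s * x) - v * (s * y)
  pascal-term s e f a b x y u v h₁ h₂ = begin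
    - s * (e * (f * a + b))
      ≈⟨ solve 5 (λ s e f a b → :- s :* (e :* (f :* a :+ b)) := :- s :* (e :* f :* a) :- s :* (e :* b)) ≈R.refl s e f a b ⟩
    - s * (e * f * a) - s * (e * b)
      ≈⟨ ≈R.+-cong (≈R.*-congˡ (≈R.sym h₁)) (≈R.-‿cong (≈R.*-congˡ (≈R.sym h₂))) ⟩
    - s * (u * x) - s * (v * y)
      ≈⟨ solve 5 (λ s u x v y → :- s :* (u :* x) :- s :* (v :* y) := u :* (:- s :* x) :- v :* (s :* y)) ≈R.refl s u x v y ⟩
    u * (- s * x) - v * (s * y) ∎
    where open SetoidReasoning ≈R.setoid

  distribʳ-difference : ∀ u v x → (u - v) * x ≈ᴿ u * x - v * x
  distribʳ-difference = solve 3 (λ u v x → (u :- v) :* x := u :* x :- v :* x) ≈R.refl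

  distribˡ-difference : ∀ u x y → u * (x - y) ≈ᴿ u * x - u * y
  distribˡ-difference = solve 3 (λ u x y → u :* (x :- y) := u :* x :- u :* y) ≈R.refl

  distribute-past : ∀ u p x q y → u * (p * x + q * y) ≈ᴿ p * (u * x) + q * (u * y)
  distribute-past = solve 5 (λ u p x q y → u :* (p :* x :+ q :* y) := p :* (u :* x) :+ q :* (u :* y)) ≈R.refl

  swap-in : ∀ a s e b → a * (s * (e * b)) ≈ᴿ s * (a * e * b)
  swap-in = solve 4 (λ a s e b → a :* (s :* (e :* b)) := s :* (a :* e :* b)) ≈R.refl

  neg-product : ∀ s e f → s * e * - f ≈ᴿ - s * (e * f)
  neg-product = solve 3 (λ s e f → s :* e :* :- f := :- s :* (e :* f)) ≈R.refl

  double : ∀ s e f → s * (s * e * f) ≈ᴿ s * s * (e * f)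
  double = solve 3 (λ s e f → s :* (s :* e :* f) := s :* s :* (e :* f)) ≈R.refl

  collect : ∀ s e p f q → s * e * p * (f * q) ≈ᴿ s * (e * f) * (p * q)
  collect = solve 5 (λ s e p f q → s :* e :* p :* (f :* q) := s :* (e :* f) :* (p :* q)) ≈R.refl

  regroup : ∀ s t e f q → s * t * (e * f * q) ≈ᴿ s * e * (t * f * q)
  regroup = solve 5 (λ s t e f q → s :* t :* (e :* f :* q) := s :* e :* (t :* f :* q)) ≈R.refl

  double-difference : ∀ a b → a - (a - b) ≈ᴿ b
  double-difference = solve 2 (λ a b → a :- (a :- b) := b) ≈R.refl

  geometric-suc : ∀ c p → (1# - p) + (1# - c) * p ≈ᴿ 1# - p * c
  geometric-suc = solve 2 (λ c p → (𝟙 :- p) :+ (𝟙 :- c) :* p := 𝟙 :- p :* c) ≈R.refl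

-- The solver normalises over an abstract ring; only the finished identities are specialised to
-- power series.
module Id = RingIdentities PSRing ℤ→PS

open import Data.Nat using (_+_; _*_)

-- Finite sums and products, and truncation modulo q^K

open CommutativeRing PSRing
  using (-‿inverseʳ; *-commutativeMonoid; +-commutativeMonoid; setoid)
  renaming ( _-_ to infixl 6 _⊝_
           ; refl to ≈-refl; sym to ≈-sym; trans to ≈-trans
           ; +-cong to ⊕-cong; *-cong to ⊗-cong; -‿cong to ⊝-cong
           ; +-congˡ to ⊕-congˡ; +-congʳ to ⊕-congʳ; *-congˡ to ⊗-congˡ; *-congʳ to ⊗-congʳ
           ; +-assoc to ⊕-assoc; +-comm to ⊕-comm; *-assoc to ⊗-assoc; *-comm to ⊗-comm
           ; +-identityˡ to ⊕-identityˡ; +-identityʳ to ⊕-identityʳ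
           ; *-identityˡ to ⊗-identityˡ; *-identityʳ to ⊗-identityʳ
           ; distribˡ to ⊗-distribˡ; zeroˡ to ⊗-zeroˡ; zeroʳ to ⊗-zeroʳ)

module Fold (M : CommutativeMonoid 0ℓ 0ℓ) where
  open CommutativeMonoid M renaming (_≈_ to _≋_; refl to ≋-refl; sym to ≋-sym; trans to ≋-trans)
  open CommutativeSemigroupProperties commutativeSemigroup using (interchange)

  fold : (ℕ → Carrier) → ℕ → Carrier
  fold f zero = ε
  fold f (suc n) = fold f n ∙ f n

  fold-cong : ∀ {f g} n → (∀ m → m < n → f m ≋ g m) → fold f n ≋ fold g n
  fold-cong zero h = ≋-refl
  fold-cong (suc n) h = ∙-cong (fold-cong n (λ m m<n → h m (ℕₚ.m≤n⇒m≤1+n m<n))) (h n ℕₚ.≤-refl)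

  fold-ε : ∀ {f} n → (∀ m → m < n → f m ≋ ε) → fold f n ≋ ε
  fold-ε zero h = ≋-refl
  fold-ε (suc n) h =
    ≋-trans (∙-cong (fold-ε n (λ m m<n → h m (ℕₚ.m≤n⇒m≤1+n m<n))) (h n ℕₚ.≤-refl)) (identityˡ ε)

  fold-∙ : ∀ f g n → fold (λ m → f m ∙ g m) n ≋ fold f n ∙ fold g n
  fold-∙ f g zero = ≋-sym (identityˡ ε)
  fold-∙ f g (suc n) = ≋-trans (∙-congʳ (fold-∙ f g n)) (interchange _ _ _ _)

  fold-split : ∀ f a b → fold f (a + b) ≋ fold f a ∙ fold (λ m → f (a + m)) b
  fold-split f a zero rewrite ℕₚ.+-identityʳ a = ≋-sym (identityʳ _)
  fold-split f a (suc b) rewrite ℕₚ.+-suc a b =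
    ≋-trans (∙-congʳ (fold-split f a b)) (assoc _ _ _)

  fold-front : ∀ f n → fold f (suc n) ≋ f 0 ∙ fold (f ∘ suc) n
  fold-front f n = ≋-trans (fold-split f 1 n) (∙-congʳ (identityˡ _))

  fold-reverse : ∀ f n → fold f n ≋ fold (λ m → f (n ∸ suc m)) n
  fold-reverse f zero = ≋-refl
  fold-reverse f (suc n) = ≋-trans (comm _ _)
    (≋-trans (∙-congˡ (fold-reverse f n)) (≋-sym (fold-front (λ m → f (n ∸ m)) n)))

  fold-single : ∀ f u n → u < n → (∀ m → m < n → m ≢ u → f m ≋ ε) → fold f n ≋ f u
  fold-single f u (suc n) u<1+n h with u ℕ.≟ n
  ... | yes refl = ≋-trans (∙-congʳ (fold-ε n (λ m m<n → h m (ℕₚ.m≤n⇒m≤1+n m<n) (ℕₚ.<⇒≢ m<n)))) (identityˡ _)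
  ... | no u≢n = ≋-trans
    (∙-cong (fold-single f u n (ℕₚ.≤∧≢⇒< (ℕₚ.≤-pred u<1+n) u≢n) (λ m m<n → h m (ℕₚ.m≤n⇒m≤1+n m<n)))
            (h n ℕₚ.≤-refl (λ n≡u → u≢n (sym n≡u))))
    (identityʳ _)

  fold-blocks : ∀ f d s → fold f (s * d) ≋ fold (λ t → fold (λ u → f (t * d + u)) d) s
  fold-blocks f d zero = ≋-refl
  fold-blocks f d (suc s) rewrite ℕₚ.+-comm d (s * d) =
    ≋-trans (fold-split f (s * d) d) (∙-congʳ (fold-blocks f d s))

open Fold +-commutativeMonoid using () renaming
  ( fold to Σ; fold-cong to Σ-cong; fold-∙ to Σ-⊕; fold-split to Σ-split
  ; fold-front to Σ-front; fold-reverse to Σ-reverse )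
open Fold *-commutativeMonoid using () renaming
  ( fold to ∏; fold-cong to ∏-cong; fold-ε to ∏-one; fold-∙ to ∏-⊗; fold-split to ∏-split
  ; fold-front to ∏-front; fold-reverse to ∏-reverse; fold-single to ∏-single; fold-blocks to ∏-blocks )

Σ-⊗ˡ : ∀ h f n → Σ (λ m → h ⊗ f m) n ≈ h ⊗ Σ f n
Σ-⊗ˡ h f zero = ≈-sym (⊗-zeroʳ h)
Σ-⊗ˡ h f (suc n) = ≈-trans (⊕-congʳ (Σ-⊗ˡ h f n)) (≈-sym (⊗-distribˡ h _ _))

infix 4 _≈[_]_

record _≈[_]_ (f : PS) (K : ℕ) (g : PS) : Set where
  constructor mkₜ
  field coeffₜ : ∀ n → n < K → f n ≡ g n
open _≈[_]_

module _ {K : ℕ} where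
  ≈ₜ-refl : ∀ {f} → f ≈[ K ] f
  ≈ₜ-refl = mkₜ λ _ _ → refl

  ≈ₜ-sym : ∀ {f g} → f ≈[ K ] g → g ≈[ K ] f
  ≈ₜ-sym p = mkₜ λ n l → sym (coeffₜ p n l)

  ≈ₜ-trans : ∀ {f g h} → f ≈[ K ] g → g ≈[ K ] h → f ≈[ K ] h
  ≈ₜ-trans p r = mkₜ λ n l → trans (coeffₜ p n l) (coeffₜ r n l)

  ≈⇒≈ₜ : ∀ {f g} → f ≈ g → f ≈[ K ] g
  ≈⇒≈ₜ p = mkₜ λ n _ → coeff p n

  opaque
   unfolding _⊕_
   ⊕-congₜ : ∀ {f f′ g g′} → f ≈[ K ] f′ → g ≈[ K ] g′ → f ⊕ g ≈[ K ] f′ ⊕ g′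
   ⊕-congₜ p r = mkₜ λ n l → cong₂ ℤ._+_ (coeffₜ p n l) (coeffₜ r n l)

   ⊝-congₜ : ∀ {f f′ g g′} → f ≈[ K ] f′ → g ≈[ K ] g′ → f ⊝ g ≈[ K ] f′ ⊝ g′
   ⊝-congₜ p r = mkₜ λ n l → cong₂ (λ x y → x ℤ.+ ℤ.- y) (coeffₜ p n l) (coeffₜ r n l)

   ⊗-congₜ : ∀ {f f′ g g′} → f ≈[ K ] f′ → g ≈[ K ] g′ → f ⊗ g ≈[ K ] f′ ⊗ g′
   ⊗-congₜ p r = mkₜ λ n l → *ₚ-cong-≤ n (λ a a≤n → coeffₜ p a (ℕₚ.≤-<-trans a≤n l))
                                         (λ a a≤n → coeffₜ r a (ℕₚ.≤-<-trans a≤n l))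

  ⊗-congₜˡ : ∀ f {g g′} → g ≈[ K ] g′ → f ⊗ g ≈[ K ] f ⊗ g′
  ⊗-congₜˡ f = ⊗-congₜ ≈ₜ-refl

  ⊗-congₜʳ : ∀ {f f′ g} → f ≈[ K ] f′ → f ⊗ g ≈[ K ] f′ ⊗ g
  ⊗-congₜʳ p = ⊗-congₜ p ≈ₜ-refl

  Σ-congₜ : ∀ {f g} n → (∀ m → m < n → f m ≈[ K ] g m) → Σ f n ≈[ K ] Σ g n
  Σ-congₜ zero h = ≈ₜ-refl
  Σ-congₜ (suc n) h = ⊕-congₜ (Σ-congₜ n (λ m l → h m (ℕₚ.m≤n⇒m≤1+n l))) (h n ℕₚ.≤-refl)

  truncSetoid : Setoid 0ℓ 0ℓ
  truncSetoid = record { Carrier = PS ; _≈_ = _≈[ K ]_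
    ; isEquivalence = record { refl = ≈ₜ-refl ; sym = ≈ₜ-sym ; trans = ≈ₜ-trans } }

≈ₜ-weaken : ∀ {K L f g} → L ≤ K → f ≈[ K ] g → f ≈[ L ] g
≈ₜ-weaken L≤K p = mkₜ λ n l → coeffₜ p n (ℕₚ.<-≤-trans l L≤K)

≈ₜ⇒≈ : ∀ {f g} → (∀ K → f ≈[ K ] g) → f ≈ g
≈ₜ⇒≈ h = mk λ n → coeffₜ (h (suc n)) n ℕₚ.≤-refl

opaque
  unfolding _⊗_
  ⊗-orderₜ : ∀ {a b f g} → f ≈[ a ] zeroₚ → g ≈[ b ] zeroₚ → f ⊗ g ≈[ a + b ] zeroₚ
  ⊗-orderₜ {a} {b} {f} {g} p r = mkₜ λ n l →
    trans (sumTo-cong n (λ i → product-zero n l i))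
          (trans (sumTo-* (+ 0) (λ _ → + 0) n) (ℤₚ.*-zeroˡ (sumTo (λ _ → + 0) n)))
    where
    product-zero : ∀ n → n < a + b → ∀ i → i ≤ n → f i ℤ.* g (n ∸ i) ≡ + 0
    product-zero n l i i≤n with ℕₚ.<-≤-connex i a
    ... | inj₁ i<a = trans (cong (ℤ._* g (n ∸ i)) (coeffₜ p i i<a)) (ℤₚ.*-zeroˡ (g (n ∸ i)))
    ... | inj₂ a≤i = trans (cong (λ x → f i ℤ.* x) (coeffₜ r (n ∸ i) n∸i<b)) (ℤₚ.*-zeroʳ (f i))
      where
      n∸i<b : n ∸ i < b
      n∸i<b = ℕₚ.≤-trans (ℕₚ.≤-reflexive (sym (ℕₚ.+-∸-assoc 1 i≤n)))
        (ℕₚ.≤-trans (ℕₚ.∸-monoʳ-≤ (suc n) a≤i) (ℕₚ.m≤n+o⇒m∸n≤o (suc n) a l))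

⊗-orderₜˡ : ∀ {a f} g → f ≈[ a ] zeroₚ → f ⊗ g ≈[ a ] zeroₚ
⊗-orderₜˡ g p = ≈ₜ-trans (⊗-congₜʳ p) (≈⇒≈ₜ (⊗-zeroˡ g))

unit-cancelₜ : ∀ {K f g h} → g ⊗ h ≈ oneₚ → f ⊗ g ≈[ K ] g → f ≈[ K ] oneₚ
unit-cancelₜ {K} {f} {g} {h} gh≈1 fg≈g = begin
  f           ≈⟨ ≈⇒≈ₜ (⊗-identityʳ f) ⟨
  f ⊗ oneₚ    ≈⟨ ≈⇒≈ₜ (⊗-congˡ gh≈1) ⟨
  f ⊗ (g ⊗ h) ≈⟨ ≈⇒≈ₜ (⊗-assoc f g h) ⟨
  f ⊗ g ⊗ h   ≈⟨ ⊗-congₜʳ fg≈g ⟩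
  g ⊗ h       ≈⟨ ≈⇒≈ₜ gh≈1 ⟩
  oneₚ        ∎
  where open SetoidReasoning (truncSetoid {K})

Σ-stable : ∀ {f} → (∀ m → f m ≈[ m ] zeroₚ) → ∀ M x → Σ f (M + x) ≈[ M ] Σ f M
Σ-stable {f} h M zero rewrite ℕₚ.+-identityʳ M = ≈ₜ-refl
Σ-stable {f} h M (suc x) rewrite ℕₚ.+-suc M x =
  ≈ₜ-trans (⊕-congₜ (Σ-stable h M x) (≈ₜ-weaken (ℕₚ.m≤m+n M x) (h (M + x)))) (≈⇒≈ₜ (⊕-identityʳ _))

-- Factors are counted from 0 but the infinite products start at m = 1, so factor m is trivial
-- modulo q^(m+1). Hence the precision `suc M`, one better than for sums.
∏-stable : ∀ {f} → (∀ m → f m ≈[ suc m ] oneₚ) → ∀ M x → ∏ f (M + x) ≈[ suc M ] ∏ f M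
∏-stable {f} h M zero rewrite ℕₚ.+-identityʳ M = ≈ₜ-refl
∏-stable {f} h M (suc x) rewrite ℕₚ.+-suc M x =
  ≈ₜ-trans (⊗-congₜ (∏-stable h M x) (≈ₜ-weaken (s≤s (ℕₚ.m≤m+n M x)) (h (M + x)))) (≈⇒≈ₜ (⊗-identityʳ _))

opaque
  unfolding _⊕_
  sumTo-Σ : ∀ (T : ℕ → PS) N n → sumTo (λ m → T m n) N ≡ Σ T (suc N) n
  sumTo-Σ T zero n = sym (ℤₚ.+-identityˡ (T 0 n))
  sumTo-Σ T (suc N) n = cong (λ x → x ℤ.+ T (suc N) n) (sumTo-Σ T N n)

-- Replaces the cut-off that varies with the coefficient by a single one, so that the laws for
-- finite sums apply.
infSum-Σ : ∀ {T} → (∀ n → T n ≈[ n ] zeroₚ) → ∀ K → infSum T ≈[ K ] Σ T K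
infSum-Σ {T} h K = mkₜ λ n n<K → trans (sumTo-Σ T n n)
  (trans (sym (coeffₜ (Σ-stable h (suc n) (K ∸ suc n)) n ℕₚ.≤-refl))
         (cong (λ M → Σ T M n) (ℕₚ.m+[n∸m]≡n n<K)))

prodList-∏ : ∀ (g : ℕ → PS) (h : ℕ → ℕ) n → prodList (map g (applyUpTo h n)) ≈ ∏ (g ∘ h) n
prodList-∏ g h zero = ≈-refl
prodList-∏ g h (suc n) = ≈-trans (≈-trans (*ₚ≈⊗ _ _) (⊗-congˡ (prodList-∏ g (h ∘ suc) n))) (≈-sym (∏-front (g ∘ h) n))

prodRange-∏ : ∀ f a n → prodRange f a n ≈ ∏ (λ t → f (a + t)) n
prodRange-∏ f a n = prodList-∏ (λ t → f (a + t)) (λ t → t) n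

-- The number of factors `M` is free, which later allows a cut-off at a multiple of 4k.
infProd-∏ : ∀ {P} → (∀ m → P (suc m) ≈[ suc m ] oneₚ) → ∀ M → infProd P ≈[ suc M ] ∏ (P ∘ suc) M
infProd-∏ {P} h M = mkₜ λ n n<1+M → trans (coeff (prodRange-∏ P 1 n) n)
  (trans (sym (coeffₜ (∏-stable h n (M ∸ n)) n ℕₚ.≤-refl))
         (cong (λ x → ∏ (P ∘ suc) x n) (ℕₚ.m+[n∸m]≡n (ℕₚ.≤-pred n<1+M))))

-- Monomials and geometric series

opaque
  unfolding _⊗_
  q^ : ℕ → PS
  q^ e = mono e

  mono≈q^ : ∀ e → mono e ≈ q^ e
  mono≈q^ e = ≈-refl

  q^-zero : q^ 0 ≈ oneₚ
  q^-zero = mk λ { zero → refl ; (suc n) → refl }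

  q^-suc-⊗ : ∀ e f n → (q^ (suc e) ⊗ f) (suc n) ≡ (q^ e ⊗ f) n
  q^-suc-⊗ e f n = trans (*ₚ-front (q^ (suc e)) f n)
    (trans (cong (λ x → x ℤ.+ (q^ e ⊗ f) n) (ℤₚ.*-zeroˡ (f (suc n)))) (ℤₚ.+-identityˡ _))

  q^-suc-⊗-0 : ∀ e f → (q^ (suc e) ⊗ f) 0 ≡ + 0
  q^-suc-⊗-0 e f = ℤₚ.*-zeroˡ (f 0)

  q^-⊗-shift : ∀ e f n → (q^ e ⊗ f) (e + n) ≡ f n
  q^-⊗-shift zero f n = coeff (≈-trans (⊗-congʳ {x = f} q^-zero) (⊗-identityˡ f)) n
  q^-⊗-shift (suc e) f n = trans (q^-suc-⊗ e f (e + n)) (q^-⊗-shift e f n)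

  q^-order : ∀ e → q^ e ≈[ e ] zeroₚ
  q^-order e = mkₜ λ n n<e → below e n n<e
    where
    below : ∀ e n → n < e → q^ e n ≡ + 0
    below (suc e) zero _ = refl
    below (suc e) (suc n) (s≤s l) = below e n l

  q^-+ : ∀ a b → q^ (a + b) ≈ q^ a ⊗ q^ b
  q^-+ a b = mk λ n → at a n
    where
    at : ∀ a n → q^ (a + b) n ≡ (q^ a ⊗ q^ b) n
    at zero n = sym (q^-⊗-shift 0 (q^ b) n)
    at (suc a) zero = sym (q^-suc-⊗-0 a (q^ b))
    at (suc a) (suc n) = trans (at a n) (sym (q^-suc-⊗ a (q^ b) n))

  -- Multiplication by `q^ e` gains `e` orders of precision. The limit of the finite triple product
  -- depends on this gain.
  q^-⊗-congₜ : ∀ e {K f g} → f ≈[ K ] g → q^ e ⊗ f ≈[ e + K ] q^ e ⊗ g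
  q^-⊗-congₜ e {K} {f} {g} p = mkₜ (at e)
    where
    at : ∀ e n → n < e + K → (q^ e ⊗ f) n ≡ (q^ e ⊗ g) n
    at zero n l = trans (q^-⊗-shift 0 f n) (trans (coeffₜ p n l) (sym (q^-⊗-shift 0 g n)))
    at (suc e) zero _ = trans (q^-suc-⊗-0 e f) (sym (q^-suc-⊗-0 e g))
    at (suc e) (suc n) (s≤s l) = trans (q^-suc-⊗ e f n) (trans (at e n l) (sym (q^-suc-⊗ e g n)))

  q^-cancel : ∀ e {f g} → q^ e ⊗ f ≈ q^ e ⊗ g → f ≈ g
  q^-cancel e {f} {g} p = mk λ n →
    trans (sym (q^-⊗-shift e f n)) (trans (coeff p (e + n)) (q^-⊗-shift e g n))

q^-cong : ∀ {a b} → a ≡ b → q^ a ≈ q^ b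
q^-cong refl = ≈-refl

q^-+ʳ : ∀ {a f} b → q^ a ≈ f → q^ (a + b) ≈ f ⊗ q^ b
q^-+ʳ {a} b p = ≈-trans (q^-+ a b) (⊗-congʳ p)

open RingProperties (CommutativeRing.ring PSRing)
  using (-‿+-comm; -‿involutive; -‿distribˡ-*; -‿distribʳ-*; -0#≈0#)

⊝-zero : ∀ f → f ⊝ zeroₚ ≈ f
⊝-zero f = ≈-trans (⊕-congˡ -0#≈0#) (⊕-identityʳ f)

powₚ-order : ∀ {c} → c 0 ≡ + 0 → ∀ t → powₚ c t ≈[ t ] zeroₚ
powₚ-order c₀≡0 zero = mkₜ λ _ ()
powₚ-order {c} c₀≡0 (suc t) = ≈ₜ-weaken (ℕₚ.≤-reflexive (ℕₚ.+-comm 1 t))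
  (≈ₜ-trans (≈⇒≈ₜ (*ₚ≈⊗ (powₚ c t) c)) (⊗-orderₜ (powₚ-order c₀≡0 t) (mkₜ λ { zero _ → c₀≡0 ; (suc n) (s≤s ()) })))

geom-inverse : ∀ {c} → c 0 ≡ + 0 → (oneₚ ⊝ c) ⊗ geom c ≈ oneₚ
geom-inverse {c} c₀≡0 = ≈ₜ⇒≈ λ K → begin
  (oneₚ ⊝ c) ⊗ geom c         ≈⟨ ⊗-congₜˡ (oneₚ ⊝ c) (infSum-Σ (powₚ-order c₀≡0) K) ⟩
  (oneₚ ⊝ c) ⊗ Σ (powₚ c) K   ≈⟨ ≈⇒≈ₜ (geometric-sum K) ⟩
  oneₚ ⊝ powₚ c K             ≈⟨ ⊝-congₜ ≈ₜ-refl (powₚ-order c₀≡0 K) ⟩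
  oneₚ ⊝ zeroₚ                ≈⟨ ≈⇒≈ₜ (⊝-zero oneₚ) ⟩
  oneₚ                        ∎
  where
  open module R {K} = SetoidReasoning (truncSetoid {K})
  geometric-sum : ∀ K → (oneₚ ⊝ c) ⊗ Σ (powₚ c) K ≈ oneₚ ⊝ powₚ c K
  geometric-sum zero = ≈-trans (⊗-zeroʳ (oneₚ ⊝ c)) (≈-sym (-‿inverseʳ oneₚ))
  geometric-sum (suc K) = ≈-trans (⊗-distribˡ (oneₚ ⊝ c) _ _)
    (≈-trans (⊕-congʳ (geometric-sum K)) (≈-trans (Id.geometric-suc c (powₚ c K)) (⊕-congˡ (⊝-cong (≈-sym (*ₚ≈⊗ _ _))))))

1-mono : ∀ e → oneₚ -ₚ mono e ≈ oneₚ ⊝ q^ e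
1-mono e = ≈-trans (-ₚ≈⊕neg oneₚ (mono e)) (⊕-congˡ (⊝-cong (mono≈q^ e)))

opaque
  1+q^⁻¹ : ℕ → PS
  1+q^⁻¹ e = geom (negₚ (mono e))

  geom≈1+q^⁻¹ : ∀ e → geom (negₚ (mono e)) ≈ 1+q^⁻¹ e
  geom≈1+q^⁻¹ e = ≈-refl

1+q^-inverse : ∀ e → 1+q^⁻¹ (e + 1) ⊗ (oneₚ ⊕ q^ (e + 1)) ≈ oneₚ
1+q^-inverse e = begin
  1+q^⁻¹ (e + 1) ⊗ (oneₚ ⊕ q^ (e + 1))
    ≈⟨ ⊗-comm _ _ ⟩
  (oneₚ ⊕ q^ (e + 1)) ⊗ 1+q^⁻¹ (e + 1)
    ≈⟨ ⊗-cong (⊕-congˡ (≈-trans (≈-sym (mono≈q^ (e + 1))) (≈-sym (≈-trans (⊝-cong (negₚ≈neg (mono (e + 1)))) (-‿involutive _)))))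
              (≈-sym (geom≈1+q^⁻¹ (e + 1))) ⟩
  (oneₚ ⊝ negₚ (mono (e + 1))) ⊗ geom (negₚ (mono (e + 1)))
    ≈⟨ geom-inverse (cong (λ x → ℤ.- mono x 0) (ℕₚ.+-comm e 1)) ⟩
  oneₚ ∎
  where open SetoidReasoning setoid

-- The recursion for the sums

-- The binomial coefficient n over 2 in a form that unfolds at `suc n` to `tri n + n`. Exponents at
-- n + 1 thus become polynomials in n and `tri n`, within reach of the solver.
tri : ℕ → ℕ
tri zero = 0
tri (suc n) = tri n + n

C2≡tri : ∀ n → n C 2 ≡ tri n
C2≡tri zero = refl
C2≡tri (suc n) = trans (sym (nCk+nC[k+1]≡[n+1]C[k+1] n 1))
  (trans (ℕₚ.+-comm (n C 1) (n C 2)) (cong₂ _+_ (C2≡tri n) (nC1≡n n)))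

σ : ℕ → PS
σ zero = oneₚ
σ (suc n) = neg (σ n)

σ-+ : ∀ a b → σ (a + b) ≈ σ a ⊗ σ b
σ-+ zero b = ≈-sym (⊗-identityˡ (σ b))
σ-+ (suc a) b = ≈-trans (⊝-cong (σ-+ a b)) (-‿distribˡ-* (σ a) (σ b))

σ-square : ∀ n → σ n ⊗ σ n ≈ oneₚ
σ-square zero = ⊗-identityˡ oneₚ
σ-square (suc n) = begin
  neg (σ n) ⊗ neg (σ n)   ≈⟨ -‿distribˡ-* (σ n) (neg (σ n)) ⟨
  neg (σ n ⊗ neg (σ n))   ≈⟨ ⊝-cong (-‿distribʳ-* (σ n) (σ n)) ⟨
  neg (neg (σ n ⊗ σ n))   ≈⟨ -‿involutive _ ⟩
  σ n ⊗ σ n               ≈⟨ σ-square n ⟩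
  oneₚ                    ∎
  where open SetoidReasoning setoid

scaleₚ-sgn : ∀ n f → scaleₚ (sgn n) f ≈ σ n ⊗ f
scaleₚ-sgn zero f = ≈-trans (mk λ n → ℤₚ.*-identityˡ (f n)) (≈-sym (⊗-identityˡ f))
scaleₚ-sgn (suc n) f = begin
  scaleₚ (ℤ.- sgn n) f      ≈⟨ (mk λ m → sym (ℤₚ.neg-distribˡ-* (sgn n) (f m))) ⟩
  negₚ (scaleₚ (sgn n) f)   ≈⟨ negₚ≈neg _ ⟩
  neg (scaleₚ (sgn n) f)    ≈⟨ ⊝-cong (scaleₚ-sgn n f) ⟩
  neg (σ n ⊗ f)             ≈⟨ -‿distribˡ-* (σ n) f ⟩
  neg (σ n) ⊗ f             ∎
  where open SetoidReasoning setoid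

numerator denominator⁻¹ : ℕ → ℕ → PS
numerator j n = ∏ (λ t → oneₚ ⊝ q^ (2 * (n + (1 + t)))) j
denominator⁻¹ j n = ∏ (λ t → 1+q^⁻¹ (2 * (n + t) + 1)) (suc j)

-- `i` is one less than the index in the theorem, so that 2i - 1 there is `2 * i + 1` here and no
-- truncated subtraction occurs.
exponent : ℕ → ℕ → ℕ → ℕ → ℕ
exponent k j i n = 4 * k * tri n + (2 * k * (j + 1) + (2 * i + 1)) * n

bracket : ℕ → ℕ → ℕ → PS
bracket j r n = (oneₚ ⊝ q^ (2 * (r + 1) * (2 * n + j + 1)))
  ⊕ q^ (2 * (n + j) + 1) ⊗ (oneₚ ⊝ q^ (2 * r * (2 * n + j + 1)))

coefficient : ℕ → ℕ → PS
coefficient j n = σ n ⊗ (numerator j n ⊗ denominator⁻¹ j n)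

-- The n-th term of the sum for index i + 1, where k = i + 1 + r.
summand : ℕ → ℕ → ℕ → ℕ → ℕ → PS
summand k j i r n = coefficient j n ⊗ q^ (exponent k j i n) ⊗ bracket j r n

module _ {k i r} (j : ℕ) (k≡ : k ≡ suc i + r) where

  term-summand : ∀ n → term k j (suc i) n ≈ summand k j i r n
  -- `term` computes with `k ∸ suc i`; the comparison is made for that value and then transported to
  -- `r`.
  term-summand n = subst (λ x → term k j (suc i) n ≈ summand k j i x n)
    (trans (cong (_∸ suc i) k≡) (ℕₚ.m+n∸m≡n (suc i) r)) (begin
    term k j (suc i) n
      ≈⟨ scaleₚ-sgn n _ ⟩
    σ n ⊗ _
      ≈⟨ ⊗-congˡ (≈-trans (*ₚ≈⊗ _ _) (⊗-cong (≈-trans (mono≈q^ _) (q^-cong exponent≡))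
           (≈-trans (*ₚ≈⊗ _ _) (⊗-cong numerator≈
             (≈-trans (*ₚ≈⊗ _ _) (⊗-cong denominator≈ bracket≈)))))) ⟩
    σ n ⊗ (q^ (exponent k j i n) ⊗ (numerator j n ⊗ (denominator⁻¹ j n ⊗ bracket j (k ∸ suc i) n)))
      ≈⟨ Id.reassociate (σ n) _ _ _ _ ⟩
    summand k j i (k ∸ suc i) n ∎)
    where
    open SetoidReasoning setoid
    exponent≡ : 4 * k * (n C 2) + (2 * k * (j + 1) + 2 * suc i ∸ 1) * n ≡ exponent k j i n
    exponent≡ rewrite C2≡tri n = cong (λ x → 4 * k * tri n + x * n)
      (cong (_∸ 1) (rearrange (2 * k * (j + 1)) i))
      where
      rearrange : ∀ a i → a + 2 * suc i ≡ suc (a + (2 * i + 1))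
      rearrange = solve-∀
    numerator≈ : prodRange (λ t → oneₚ -ₚ mono (2 * (n + t))) 1 j ≈ numerator j n
    numerator≈ = ≈-trans (prodRange-∏ (λ t → oneₚ -ₚ mono (2 * (n + t))) 1 j) (∏-cong j λ _ _ → 1-mono _)
    denominator≈ : prodRange (λ t → geom (negₚ (mono (2 * (n + t) + 1)))) 0 (suc j) ≈ denominator⁻¹ j n
    denominator≈ = ≈-trans (prodRange-∏ (λ t → geom (negₚ (mono (2 * (n + t) + 1)))) 0 (suc j))
      (∏-cong (suc j) λ _ _ → geom≈1+q^⁻¹ _)
    bracket≈ : _ ≈ bracket j (k ∸ suc i) n
    bracket≈ = ≈-trans (+ₚ≈⊕ _ _)
      (⊕-cong (1-mono _) (≈-trans (*ₚ≈⊗ _ _) (⊗-cong (mono≈q^ _) (1-mono _))))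

exponent-≥ : ∀ k j i n → n ≤ exponent k j i n
exponent-≥ k j i n = ℕₚ.≤-trans (ℕₚ.m≤n+m n _) (ℕₚ.≤-reflexive (sym (rearrange (4 * k * tri n) (2 * k * (j + 1)) i n)))
  where
  rearrange : ∀ a b i n → a + (b + (2 * i + 1)) * n ≡ a + b * n + 2 * i * n + n
  rearrange = solve-∀

order-factor : ∀ {e n} f g → n ≤ e → f ⊗ q^ e ⊗ g ≈[ n ] zeroₚ
order-factor {e} f g n≤e = ⊗-orderₜˡ g (≈ₜ-trans (≈⇒≈ₜ (⊗-comm f (q^ e)))
  (⊗-orderₜˡ f (≈ₜ-weaken n≤e (q^-order e))))

summand-order : ∀ k j i r n → summand k j i r n ≈[ n ] zeroₚ
summand-order k j i r n = order-factor _ _ (exponent-≥ k j i n)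

infSum-summand : ∀ {k} j i r → k ≡ suc i + r → ∀ K → infSum (term k j (suc i)) ≈[ K ] Σ (summand k j i r) K
infSum-summand {k} j i r k≡ K = ≈ₜ-trans
  (infSum-Σ (λ n → ≈ₜ-trans (≈⇒≈ₜ (term-summand j k≡ n)) (summand-order k j i r n)) K)
  (≈⇒≈ₜ (Σ-cong K λ n _ → term-summand j k≡ n))

-- Telescoping and the comparison of neighbouring shelves

Σ-telescope : ∀ (L R U W : ℕ → PS) → (∀ n → L n ≈ U n ⊕ W n) → (∀ n → R n ≈ U n ⊕ W (suc n)) →
              ∀ M → Σ L M ⊕ W M ≈ Σ R M ⊕ W 0
Σ-telescope L R U W hL hR zero = ≈-refl
Σ-telescope L R U W hL hR (suc M) = begin
  Σ L M ⊕ L M ⊕ W (suc M)            ≈⟨ ⊕-congʳ (⊕-congˡ (hL M)) ⟩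
  Σ L M ⊕ (U M ⊕ W M) ⊕ W (suc M)    ≈⟨ Id.shuffle _ _ _ _ ⟩
  Σ L M ⊕ W M ⊕ (U M ⊕ W (suc M))    ≈⟨ ⊕-cong (Σ-telescope L R U W hL hR M) (≈-sym (hR M)) ⟩
  Σ R M ⊕ W 0 ⊕ R M                  ≈⟨ Id.swap-last _ _ _ ⟩
  Σ R M ⊕ R M ⊕ W 0                  ∎
  where open SetoidReasoning setoid

-- Of the two boundary terms of the finite telescope, `W K` vanishes modulo q^K by its order and
-- `W 0` vanishes outright.
Σ-telescopeₜ : ∀ (L R U W : ℕ → PS) → (∀ n → L n ≈ U n ⊕ W n) → (∀ n → R n ≈ U n ⊕ W (suc n)) →
               W 0 ≈ zeroₚ → (∀ n → W n ≈[ n ] zeroₚ) → ∀ K → Σ L K ≈[ K ] Σ R K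
Σ-telescopeₜ L R U W hL hR W₀ hW K = begin
  Σ L K           ≈⟨ ≈⇒≈ₜ (⊕-identityʳ _) ⟨
  Σ L K ⊕ zeroₚ   ≈⟨ ⊕-congₜ ≈ₜ-refl (hW K) ⟨
  Σ L K ⊕ W K     ≈⟨ ≈⇒≈ₜ (Σ-telescope L R U W hL hR K) ⟩
  Σ R K ⊕ W 0     ≈⟨ ≈⇒≈ₜ (⊕-congˡ W₀) ⟩
  Σ R K ⊕ zeroₚ   ≈⟨ ≈⇒≈ₜ (⊕-identityʳ _) ⟩
  Σ R K           ∎
  where open SetoidReasoning (truncSetoid {K})

-- Both sides are the product of 1 - q^(2m) over n + 1 ≤ m ≤ n + j + 1. The factor m = n + 1 is
-- multiplied in rather than divided out.
numerator-suc : ∀ j n → numerator j (suc n) ⊗ (oneₚ ⊝ q^ (2 * suc n)) ≈ numerator (suc j) n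
numerator-suc j n = begin
  numerator j (suc n) ⊗ (oneₚ ⊝ q^ (2 * suc n))
    ≈⟨ ⊗-comm _ _ ⟩
  (oneₚ ⊝ q^ (2 * suc n)) ⊗ numerator j (suc n)
    ≈⟨ ⊗-cong (⊕-congˡ (⊝-cong (q^-cong (cong (2 *_) (ℕₚ.+-comm 1 n)))))
              (∏-cong j λ t _ → ⊕-congˡ (⊝-cong (q^-cong (cong (2 *_) (sym (ℕₚ.+-suc n (suc t))))))) ⟩
  (oneₚ ⊝ q^ (2 * (n + 1))) ⊗ ∏ (λ t → oneₚ ⊝ q^ (2 * (n + (1 + suc t)))) j
    ≈⟨ ∏-front (λ t → oneₚ ⊝ q^ (2 * (n + (1 + t)))) j ⟨
  numerator (suc j) n ∎
  where open SetoidReasoning setoid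

-- The denominators run over n + 1 ≤ m ≤ n + j + 1 on the left and over n ≤ m ≤ n + j + 1 on the
-- right; the polynomial factor removes m = n.
denominator⁻¹-suc : ∀ j n →
  denominator⁻¹ j (suc n) ≈ (oneₚ ⊕ q^ (2 * n) ⊗ q^ 1) ⊗ denominator⁻¹ (suc j) n
denominator⁻¹-suc j n = begin
  denominator⁻¹ j (suc n)
    ≈⟨ ⊗-identityˡ _ ⟨
  oneₚ ⊗ denominator⁻¹ j (suc n)
    ≈⟨ ⊗-congʳ (1+q^-inverse (2 * n)) ⟨
  1+q^⁻¹ (2 * n + 1) ⊗ (oneₚ ⊕ q^ (2 * n + 1)) ⊗ denominator⁻¹ j (suc n)
    ≈⟨ ≈-trans (⊗-congʳ (⊗-comm _ _)) (⊗-assoc _ _ _) ⟩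
  (oneₚ ⊕ q^ (2 * n + 1)) ⊗ (1+q^⁻¹ (2 * n + 1) ⊗ denominator⁻¹ j (suc n))
    ≈⟨ ⊗-cong (⊕-congˡ (q^-+ (2 * n) 1))
              (⊗-cong (factor-cong (sym (ℕₚ.+-identityʳ n)))
                      (∏-cong (suc j) λ t _ → factor-cong (sym (ℕₚ.+-suc n t)))) ⟩
  (oneₚ ⊕ q^ (2 * n) ⊗ q^ 1) ⊗
    (factor (n + 0) ⊗ ∏ (λ t → factor (n + suc t)) (suc j))
    ≈⟨ ⊗-congˡ (∏-front (λ t → factor (n + t)) (suc j)) ⟨
  (oneₚ ⊕ q^ (2 * n) ⊗ q^ 1) ⊗ denominator⁻¹ (suc j) n ∎
  where
  open SetoidReasoning setoid
  factor : ℕ → PS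
  factor m = 1+q^⁻¹ (2 * m + 1)
  factor-cong : ∀ {a b} → a ≡ b → factor a ≈ factor b
  factor-cong refl = ≈-refl

-- All end factors of the windows, and the steps from one bracket exponent to the next, are
-- monomials in these three series. Identities between powers of q thereby turn into polynomial
-- identities.
module Variables (j n : ℕ) where
  X Y Z : PS
  X = q^ (2 * n)
  Y = q^ (2 * (n + j) + 1)
  Z = q^ 1

  YXZ : q^ (2 * (2 * n + j + 1)) ≈ Y ⊗ X ⊗ Z
  YXZ = ≈-trans (q^-cong (exponents j n)) (q^-+ʳ 1 (q^-+ʳ (2 * n) ≈-refl))
    where
    exponents : ∀ j n → 2 * (2 * n + j + 1) ≡ 2 * (n + j) + 1 + 2 * n + 1
    exponents = solve-∀

  YXZZZ : q^ (2 * (2 * n + suc j + 1)) ≈ Y ⊗ X ⊗ Z ⊗ Z ⊗ Z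
  YXZZZ = ≈-trans (q^-cong (exponents j n)) (q^-+ʳ 1 (q^-+ʳ 1 (q^-+ʳ 1 (q^-+ʳ (2 * n) ≈-refl))))
    where
    exponents : ∀ j n → 2 * (2 * n + suc j + 1) ≡ 2 * (n + j) + 1 + 2 * n + 1 + 1 + 1
    exponents = solve-∀

  YZ : q^ (2 * (n + suc j)) ≈ Y ⊗ Z
  YZ = ≈-trans (q^-cong (exponents j n)) (q^-+ʳ 1 ≈-refl)
    where
    exponents : ∀ j n → 2 * (n + suc j) ≡ 2 * (n + j) + 1 + 1
    exponents = solve-∀

  YZZ : q^ (2 * (n + suc j) + 1) ≈ Y ⊗ Z ⊗ Z
  YZZ = q^-+ʳ 1 YZ

  YZZ′ : q^ (2 * (suc n + j) + 1) ≈ Y ⊗ Z ⊗ Z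
  YZZ′ = ≈-trans (q^-cong (cong (λ x → 2 * x + 1) (sym (ℕₚ.+-suc n j)))) YZZ

  P Q g : PS
  P = numerator j n
  Q = denominator⁻¹ j n
  g = 1+q^⁻¹ (2 * (n + suc j) + 1)

  coefficient-suc : coefficient (suc j) n ≈ σ n ⊗ (P ⊗ (oneₚ ⊝ Y ⊗ Z) ⊗ (Q ⊗ g))
  coefficient-suc = ⊗-congˡ (⊗-congʳ (⊗-congˡ (⊕-congˡ (⊝-cong YZ))))

  numerator-next : numerator j (suc n) ⊗ (oneₚ ⊝ q^ (2 * suc n)) ≈ P ⊗ (oneₚ ⊝ Y ⊗ Z)
  numerator-next = ≈-trans (numerator-suc j n) (⊗-congˡ (⊕-congˡ (⊝-cong YZ)))

  g-inverse : g ⊗ (oneₚ ⊕ Y ⊗ Z ⊗ Z) ≈ oneₚ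
  g-inverse = ≈-trans (⊗-congˡ (⊕-congˡ (≈-sym YZZ))) (1+q^-inverse (2 * (n + suc j)))

  -- `V` stays a parameter so that the brackets of two neighbouring indices can be written with one
  -- common monomial.
  bracket-of : ∀ {V} r → q^ (2 * r * (2 * n + j + 1)) ≈ V →
    bracket j r n ≈ (oneₚ ⊝ V ⊗ (Y ⊗ X ⊗ Z)) ⊕ Y ⊗ (oneₚ ⊝ V)
  bracket-of {V} r hV = ⊕-cong (⊕-congˡ (⊝-cong (begin
      q^ (2 * (r + 1) * (2 * n + j + 1))
        ≈⟨ q^-cong (exponents r (2 * n + j + 1)) ⟩
      q^ (2 * r * (2 * n + j + 1) + 2 * (2 * n + j + 1))
        ≈⟨ q^-+ _ _ ⟩
      q^ (2 * r * (2 * n + j + 1)) ⊗ q^ (2 * (2 * n + j + 1))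
        ≈⟨ ⊗-cong hV YXZ ⟩
      V ⊗ (Y ⊗ X ⊗ Z) ∎)))
    (⊗-congˡ (⊕-congˡ (⊝-cong hV)))
    where
    open SetoidReasoning setoid
    exponents : ∀ r m → 2 * (r + 1) * m ≡ 2 * r * m + 2 * m
    exponents = solve-∀

  bracket-suc-of : ∀ {V} r → q^ (2 * r * (2 * n + suc j + 1)) ≈ V →
    bracket (suc j) r n ≈ (oneₚ ⊝ V ⊗ (Y ⊗ X ⊗ Z ⊗ Z ⊗ Z)) ⊕ Y ⊗ Z ⊗ Z ⊗ (oneₚ ⊝ V)
  bracket-suc-of {V} r hV = ⊕-cong (⊕-congˡ (⊝-cong (begin
      q^ (2 * (r + 1) * (2 * n + suc j + 1))
        ≈⟨ q^-cong (exponents r (2 * n + suc j + 1)) ⟩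
      q^ (2 * r * (2 * n + suc j + 1) + 2 * (2 * n + suc j + 1))
        ≈⟨ q^-+ _ _ ⟩
      q^ (2 * r * (2 * n + suc j + 1)) ⊗ q^ (2 * (2 * n + suc j + 1))
        ≈⟨ ⊗-cong hV YXZZZ ⟩
      V ⊗ (Y ⊗ X ⊗ Z ⊗ Z ⊗ Z) ∎)))
    (⊗-cong YZZ (⊕-congˡ (⊝-cong hV)))
    where
    open SetoidReasoning setoid
    exponents : ∀ r m → 2 * (r + 1) * m ≡ 2 * r * m + 2 * m
    exponents = solve-∀

  q^-suc-of : ∀ {V} r m {w} → q^ (2 * r * m) ≈ V → q^ (2 * m) ≈ w → q^ (2 * suc r * m) ≈ V ⊗ w
  q^-suc-of r m hV hw = ≈-trans (q^-cong (exponents r m)) (≈-trans (q^-+ _ _) (⊗-cong hV hw))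
    where
    exponents : ∀ r m → 2 * suc r * m ≡ 2 * r * m + 2 * m
    exponents = solve-∀

q^-absorb : ∀ {a e f} m b → q^ (a + e) ≈ f → q^ a ⊗ (m ⊗ q^ e ⊗ b) ≈ m ⊗ f ⊗ b
q^-absorb {a} {e} {f} m b h = begin
  q^ a ⊗ (m ⊗ q^ e ⊗ b)   ≈⟨ Id.absorb (q^ a) m (q^ e) b ⟩
  m ⊗ (q^ a ⊗ q^ e) ⊗ b   ≈⟨ ⊗-congʳ (⊗-congˡ (≈-trans (≈-sym (q^-+ a e)) h)) ⟩
  m ⊗ f ⊗ b               ∎
  where open SetoidReasoning setoid

1-q^0 : oneₚ ⊝ q^ 0 ≈ zeroₚ
1-q^0 = ≈-trans (⊕-congˡ (⊝-cong q^-zero)) (-‿inverseʳ oneₚ)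

Σ-neg : ∀ f n → Σ (λ m → neg (f m)) n ≈ neg (Σ f n)
Σ-neg f zero = ≈-sym -0#≈0#
Σ-neg f (suc n) = ≈-trans (⊕-congʳ (Σ-neg f n)) (-‿+-comm (Σ f n) (f n))

-- The recursion for index i + 2 divides by q to the power 2(j+1)(i+1), here `suc a`. This exponent
-- is positive, and its predecessor `a` serves the term with the additional factor 1/q. Reflection
-- sends the index i + 2 to r + 1, so `i` and `r` change places in `L`.
module Step (i r j : ℕ) {a : ℕ} (a≡ : 2 * suc j * suc i ≡ suc a) where

  k : ℕ
  k = suc (suc i) + r

  L R U W : ℕ → PS
  L n = summand k j r (suc i) n ⊝ summand k j (suc r) i n
  R n = q^ (suc a) ⊗ summand k (suc j) (suc i) r n ⊕ q^ a ⊗ summand k (suc j) i (suc r) n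
  W n = coefficient j n ⊗ q^ (exponent k j r n) ⊗ ((oneₚ ⊝ q^ (2 * n)) ⊗ (oneₚ ⊕ q^ (2 * (n + j) + 1)))
  -- The monomial of the second summand of `R n`; the first summand has q^(2n+1) in addition. On the
  -- side of `L` it arises as `A * D * Y * X` in `step-lhs`.
  B : ℕ → PS
  B n = q^ (exponent k j r n) ⊗ q^ (2 * i * (2 * n + j + 1)) ⊗ q^ (2 * (n + j) + 1) ⊗ q^ (2 * n)
  U n = coefficient j n ⊗ B n ⊗ ((oneₚ ⊝ Y ⊗ Z) ⊗ (oneₚ ⊕ X ⊗ Z))
    where open Variables j n

  exponent-L : ∀ n → exponent k j (suc r) n ≡ exponent k j r n + 2 * n
  exponent-L n = go (4 * k * tri n) (2 * k * (j + 1)) r n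
    where
    go : ∀ a b r n → a + (b + (2 * suc r + 1)) * n ≡ a + (b + (2 * r + 1)) * n + 2 * n
    go = solve-∀

  exponent-R₂ : ∀ n → a + exponent k (suc j) i n
    ≡ exponent k j r n + 2 * i * (2 * n + j + 1) + (2 * (n + j) + 1) + 2 * n
  -- One is added on both sides so that `a≡` can replace `suc a` by the explicit product, which the
  -- solver can handle.
  exponent-R₂ n = ℕₚ.suc-injective (trans (cong (_+ exponent k (suc j) i n) (sym a≡)) (go i r j n (tri n)))
    where
    go : ∀ i r j n t → 2 * suc j * suc i + (4 * (suc (suc i) + r) * t + (2 * (suc (suc i) + r) * (suc j + 1) + (2 * i + 1)) * n)
      ≡ suc (4 * (suc (suc i) + r) * t + (2 * (suc (suc i) + r) * (j + 1) + (2 * r + 1)) * n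
             + 2 * i * (2 * n + j + 1) + (2 * (n + j) + 1) + 2 * n)
    go = solve-∀

  exponent-R₁ : ∀ n → suc a + exponent k (suc j) (suc i) n
    ≡ exponent k j r n + 2 * i * (2 * n + j + 1) + (2 * (n + j) + 1) + 2 * n + (2 * n + 1)
  exponent-R₁ n = trans (cong (λ x → suc a + x) (split (4 * k * tri n) (2 * k * (suc j + 1)) i n))
    (trans (move a (exponent k (suc j) i n) n) (cong (_+ (2 * n + 1)) (exponent-R₂ n)))
    where
    split : ∀ a b i n → a + (b + (2 * suc i + 1)) * n ≡ a + (b + (2 * i + 1)) * n + 2 * n
    split = solve-∀
    move : ∀ a e n → suc a + (e + 2 * n) ≡ a + e + (2 * n + 1)
    move = solve-∀

  exponent-W : ∀ n → exponent k j r (suc n)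
    ≡ exponent k j r n + 2 * i * (2 * n + j + 1) + (2 * (n + j) + 1) + 2 * n
      + (2 * r * (2 * n + suc j + 1) + 2 * (2 * n + suc j + 1))
  exponent-W n = go i r j n (tri n)
    where
    go : ∀ i r j n t → 4 * (suc (suc i) + r) * (t + n) + (2 * (suc (suc i) + r) * (j + 1) + (2 * r + 1)) * suc n
      ≡ 4 * (suc (suc i) + r) * t + (2 * (suc (suc i) + r) * (j + 1) + (2 * r + 1)) * n
        + 2 * i * (2 * n + j + 1) + (2 * (n + j) + 1) + 2 * n
        + (2 * r * (2 * n + suc j + 1) + 2 * (2 * n + suc j + 1))
    go = solve-∀

  B-spec : ∀ {e} n → e ≡ exponent k j r n + 2 * i * (2 * n + j + 1) + (2 * (n + j) + 1) + 2 * n → q^ e ≈ B n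
  B-spec n e≡ = ≈-trans (q^-cong e≡) (q^-+ʳ (2 * n) (q^-+ʳ (2 * (n + j) + 1) (q^-+ _ _)))

  L≈U+W : ∀ n → L n ≈ U n ⊕ W n
  L≈U+W n = begin
    L n
      ≈⟨ ⊕-cong (⊗-congˡ (bracket-of (suc i) (q^-suc-of i _ ≈-refl YXZ)))
                (⊝-cong (⊗-cong (⊗-congˡ (≈-trans (q^-cong (exponent-L n)) (q^-+ _ _)))
                                (bracket-of i ≈-refl))) ⟩
    (m ⊗ A ⊗ ((oneₚ ⊝ D ⊗ (Y ⊗ X ⊗ Z) ⊗ (Y ⊗ X ⊗ Z)) ⊕ Y ⊗ (oneₚ ⊝ D ⊗ (Y ⊗ X ⊗ Z))))
      ⊝ (m ⊗ (A ⊗ X) ⊗ ((oneₚ ⊝ D ⊗ (Y ⊗ X ⊗ Z)) ⊕ Y ⊗ (oneₚ ⊝ D)))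
      ≈⟨ Id.step-lhs m A D Y X Z ⟩
    U n ⊕ W n ∎
    where
    open SetoidReasoning setoid
    open Variables j n
    m A D : PS
    m = coefficient j n
    A = q^ (exponent k j r n)
    D = q^ (2 * i * (2 * n + j + 1))

  R≈U+W : ∀ n → R n ≈ U n ⊕ W (suc n)
  R≈U+W n = begin
    R n
      ≈⟨ ⊕-cong (q^-absorb _ _ (≈-trans (q^-cong (exponent-R₁ n)) (≈-trans (q^-+ _ _) (⊗-cong (B-spec n refl) (q^-+ _ _)))))
                (q^-absorb _ _ (B-spec n (exponent-R₂ n))) ⟩
    coefficient (suc j) n ⊗ (B n ⊗ (X ⊗ Z)) ⊗ bracket (suc j) r n
      ⊕ coefficient (suc j) n ⊗ B n ⊗ bracket (suc j) (suc r) n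
      ≈⟨ ⊕-cong (⊗-cong (⊗-congʳ coefficient-suc) (bracket-suc-of r ≈-refl))
                (⊗-cong (⊗-congʳ coefficient-suc) (bracket-suc-of (suc r) (q^-suc-of r _ ≈-refl YXZZZ))) ⟩
    m ⊗ (B n ⊗ (X ⊗ Z)) ⊗ ((oneₚ ⊝ V ⊗ w) ⊕ Y ⊗ Z ⊗ Z ⊗ (oneₚ ⊝ V))
      ⊕ m ⊗ B n ⊗ ((oneₚ ⊝ V ⊗ w ⊗ w) ⊕ Y ⊗ Z ⊗ Z ⊗ (oneₚ ⊝ V ⊗ w))
      ≈⟨ Id.step-rhs m (B n) Y X Z V ⟩
    m ⊗ B n ⊗ (oneₚ ⊕ X ⊗ Z) ⊗ (oneₚ ⊝ V ⊗ w) ⊗ (oneₚ ⊕ Y ⊗ Z ⊗ Z)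
      ≈⟨ Id.step-next (σ n) P Q g (B n) (V ⊗ w) _ _ _ _ _ _ numerator-next (denominator⁻¹-suc j n) g-inverse ⟩
    U n ⊕ neg (σ n) ⊗ (numerator j (suc n) ⊗ denominator⁻¹ j (suc n)) ⊗ (B n ⊗ (V ⊗ w))
      ⊗ ((oneₚ ⊝ q^ (2 * suc n)) ⊗ (oneₚ ⊕ Y ⊗ Z ⊗ Z))
      ≈⟨ ⊕-congˡ (⊗-cong (⊗-congˡ (≈-sym exponent-W≈)) (⊗-congˡ (⊕-congˡ (≈-sym YZZ′)))) ⟩
    U n ⊕ W (suc n) ∎
    where
    open SetoidReasoning setoid
    open Variables j n
    m V w : PS
    m = σ n ⊗ (P ⊗ (oneₚ ⊝ Y ⊗ Z) ⊗ (Q ⊗ g))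
    V = q^ (2 * r * (2 * n + suc j + 1))
    w = Y ⊗ X ⊗ Z ⊗ Z ⊗ Z
    exponent-W≈ : q^ (exponent k j r (suc n)) ≈ B n ⊗ (V ⊗ w)
    exponent-W≈ = ≈-trans (q^-cong (exponent-W n))
      (≈-trans (q^-+ _ _) (⊗-cong (B-spec n refl) (≈-trans (q^-+ _ _) (⊗-congˡ YXZZZ))))

  W₀ : W 0 ≈ zeroₚ
  W₀ = ≈-trans (⊗-congˡ (≈-trans (⊗-congʳ 1-q^0) (⊗-zeroˡ _))) (⊗-zeroʳ _)

  infSum-step : infSum (term k j (suc r)) ⊝ infSum (term k j (suc (suc r)))
    ≈ q^ (suc a) ⊗ infSum (term k (suc j) (suc (suc i))) ⊕ q^ a ⊗ infSum (term k (suc j) (suc i))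
  infSum-step = ≈ₜ⇒≈ λ K → let open SetoidReasoning (truncSetoid {K}) in begin
    infSum (term k j (suc r)) ⊝ infSum (term k j (suc (suc r)))
      ≈⟨ ⊝-congₜ (infSum-summand j r (suc i) (k≡₁ i r) K) (infSum-summand j (suc r) i (k≡₂ i r) K) ⟩
    Σ (summand k j r (suc i)) K ⊝ Σ (summand k j (suc r) i) K
      ≈⟨ ≈⇒≈ₜ (⊕-congˡ (Σ-neg (summand k j (suc r) i) K)) ⟨
    Σ (summand k j r (suc i)) K ⊕ Σ (λ n → neg (summand k j (suc r) i n)) K
      ≈⟨ ≈⇒≈ₜ (Σ-⊕ _ _ K) ⟨
    Σ L K
      ≈⟨ Σ-telescopeₜ L R U W L≈U+W R≈U+W W₀ (λ n → order-factor _ _ (exponent-≥ k j r n)) K ⟩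
    Σ R K
      ≈⟨ ≈⇒≈ₜ (≈-trans (Σ-⊕ _ _ K) (⊕-cong (Σ-⊗ˡ _ _ K) (Σ-⊗ˡ _ _ K))) ⟩
    q^ (suc a) ⊗ Σ (summand k (suc j) (suc i) r) K ⊕ q^ a ⊗ Σ (summand k (suc j) i (suc r)) K
      ≈⟨ ⊕-congₜ (⊗-congₜˡ _ (infSum-summand (suc j) (suc i) r refl K))
                 (⊗-congₜˡ _ (infSum-summand (suc j) i (suc r) (cong suc (sym (ℕₚ.+-suc i r))) K)) ⟨
    q^ (suc a) ⊗ infSum (term k (suc j) (suc (suc i))) ⊕ q^ a ⊗ infSum (term k (suc j) (suc i)) ∎
    where
    k≡₁ : ∀ i r → suc (suc i) + r ≡ suc r + suc i
    k≡₁ = solve-∀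
    k≡₂ : ∀ i r → suc (suc i) + r ≡ suc (suc r) + i
    k≡₂ = solve-∀

-- Consecutive shelves overlap in one index: index 1 of shelf j + 1 is index k of shelf j. The
-- formula gives two different series for it, and these are compared here, with k = r + 1.
module FirstStep (r j : ℕ) where

  L R U W : ℕ → PS
  L n = summand (suc r) j r 0 n
  R n = summand (suc r) (suc j) 0 r n
  W n = coefficient j n ⊗ q^ (exponent (suc r) j r n) ⊗ (oneₚ ⊝ q^ (2 * n))
  U n = coefficient j n ⊗ (q^ (exponent (suc r) j r n) ⊗ X) ⊗ (oneₚ ⊝ Y ⊗ Z)
    where open Variables j n

  exponent-R : ∀ n → exponent (suc r) (suc j) 0 n ≡ exponent (suc r) j r n + 2 * n
  exponent-R n = go r j n (tri n)
    where
    go : ∀ r j n t → 4 * suc r * t + (2 * suc r * (suc j + 1) + (2 * 0 + 1)) * n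
      ≡ 4 * suc r * t + (2 * suc r * (j + 1) + (2 * r + 1)) * n + 2 * n
    go = solve-∀

  exponent-W : ∀ n → exponent (suc r) j r (suc n)
    ≡ exponent (suc r) j r n + 2 * n + 2 * r * (2 * n + suc j + 1) + (2 * (n + j) + 1) + 1 + 1
  exponent-W n = go r j n (tri n)
    where
    go : ∀ r j n t → 4 * suc r * (t + n) + (2 * suc r * (j + 1) + (2 * r + 1)) * suc n
      ≡ 4 * suc r * t + (2 * suc r * (j + 1) + (2 * r + 1)) * n
        + 2 * n + 2 * r * (2 * n + suc j + 1) + (2 * (n + j) + 1) + 1 + 1
    go = solve-∀

  L≈U+W : ∀ n → L n ≈ U n ⊕ W n
  L≈U+W n = ≈-trans (⊗-congˡ (⊕-cong (⊕-congˡ (⊝-cong YXZ)) (⊗-congˡ (⊕-congˡ (⊝-cong q^-zero)))))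
    (Id.first-lhs (coefficient j n) _ Y X Z)
    where open Variables j n

  R≈U+W : ∀ n → R n ≈ U n ⊕ W (suc n)
  R≈U+W n = begin
    R n
      ≈⟨ ⊗-cong (⊗-cong coefficient-suc (≈-trans (q^-cong (exponent-R n)) (q^-+ _ _))) (bracket-suc-of r ≈-refl) ⟩
    σ n ⊗ (P ⊗ (oneₚ ⊝ Y ⊗ Z) ⊗ (Q ⊗ g)) ⊗ (A ⊗ X)
      ⊗ ((oneₚ ⊝ V ⊗ (Y ⊗ X ⊗ Z ⊗ Z ⊗ Z)) ⊕ Y ⊗ Z ⊗ Z ⊗ (oneₚ ⊝ V))
      ≈⟨ Id.first-next (σ n) P Q g (A ⊗ X) Y X Z V _ _ _ _ numerator-next (denominator⁻¹-suc j n) g-inverse ⟩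
    U n ⊕ neg (σ n) ⊗ (numerator j (suc n) ⊗ denominator⁻¹ j (suc n)) ⊗ (A ⊗ X ⊗ V ⊗ Y ⊗ Z ⊗ Z)
      ⊗ (oneₚ ⊝ q^ (2 * suc n))
      ≈⟨ ⊕-congˡ (⊗-congʳ (⊗-congˡ (≈-sym (≈-trans (q^-cong (exponent-W n))
           (q^-+ʳ _ (q^-+ʳ _ (q^-+ʳ _ (q^-+ʳ _ (q^-+ _ _))))))))) ⟩
    U n ⊕ W (suc n) ∎
    where
    open SetoidReasoning setoid
    open Variables j n
    A V : PS
    A = q^ (exponent (suc r) j r n)
    V = q^ (2 * r * (2 * n + suc j + 1))

  infSum-first : infSum (term (suc r) j (suc r)) ≈ infSum (term (suc r) (suc j) 1)
  infSum-first = ≈ₜ⇒≈ λ K → let open SetoidReasoning (truncSetoid {K}) in begin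
    infSum (term (suc r) j (suc r))   ≈⟨ infSum-summand j r 0 (sym (ℕₚ.+-identityʳ (suc r))) K ⟩
    Σ L K                             ≈⟨ Σ-telescopeₜ L R U W L≈U+W R≈U+W
                                           (≈-trans (⊗-congˡ 1-q^0) (⊗-zeroʳ _))
                                           (λ n → order-factor _ _ (exponent-≥ (suc r) j r n)) K ⟩
    Σ R K                             ≈⟨ infSum-summand (suc j) 0 r refl K ⟨
    infSum (term (suc r) (suc j) 1)   ∎

-- The finite form of the triple product

tri-+ : ∀ m n → tri (m + n) ≡ tri m + tri n + m * n
tri-+ zero n = sym (ℕₚ.+-identityʳ (tri n))
tri-+ (suc m) n = trans (cong (_+ (m + n)) (tri-+ m n)) (go (tri m) (tri n) m n)
  where
  go : ∀ a b m n → a + b + m * n + (m + n) ≡ a + m + b + (n + m * n)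
  go = solve-∀

tri-square : ∀ n → tri n + tri n + n ≡ n * n
tri-square zero = refl
tri-square (suc n) = trans (go₁ (tri n) n) (trans (cong (λ x → x + n + n + 1) (tri-square n)) (go₂ n))
  where
  go₁ : ∀ t n → t + n + (t + n) + suc n ≡ t + t + n + n + n + 1
  go₁ = solve-∀
  go₂ : ∀ n → n * n + n + n + 1 ≡ suc n * suc n
  go₂ = solve-∀

-- Gaussian binomial coefficients and Cauchy's theorem in base q^d

module _ (d : ℕ) where

  pochhammer : ℕ → PS
  pochhammer = ∏ (λ m → oneₚ ⊝ q^ (d * suc m))

  -- The Gaussian binomial coefficient in base q^d, by Pascal's rule instead of a quotient of
  -- q-factorials.
  qbinom : ℕ → ℕ → PS
  qbinom M zero = oneₚ
  qbinom zero (suc N) = zeroₚ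
  qbinom (suc M) (suc N) = q^ (d * suc N) ⊗ qbinom M (suc N) ⊕ qbinom M N

  qbinom-> : ∀ M N → M < N → qbinom M N ≈ zeroₚ
  qbinom-> zero (suc N) _ = ≈-refl
  qbinom-> (suc M) (suc N) (s≤s M<N) = begin
    q^ (d * suc N) ⊗ qbinom M (suc N) ⊕ qbinom M N
      ≈⟨ ⊕-cong (⊗-congˡ (qbinom-> M (suc N) (ℕₚ.m≤n⇒m≤1+n M<N))) (qbinom-> M N M<N) ⟩
    q^ (d * suc N) ⊗ zeroₚ ⊕ zeroₚ
      ≈⟨ ≈-trans (⊕-identityʳ _) (⊗-zeroʳ _) ⟩
    zeroₚ ∎
    where open SetoidReasoning setoid

  qbinom-diagonal : ∀ M → qbinom M M ≈ oneₚ
  qbinom-diagonal zero = ≈-refl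
  qbinom-diagonal (suc M) = begin
    q^ (d * suc M) ⊗ qbinom M (suc M) ⊕ qbinom M M
      ≈⟨ ⊕-cong (⊗-congˡ (qbinom-> M (suc M) ℕₚ.≤-refl)) (qbinom-diagonal M) ⟩
    q^ (d * suc M) ⊗ zeroₚ ⊕ oneₚ
      ≈⟨ ≈-trans (⊕-congʳ (⊗-zeroʳ _)) (⊕-identityˡ _) ⟩
    oneₚ ∎
    where open SetoidReasoning setoid

  -- The factorial formula with denominators cleared. Writing the upper entry as `a + b` lets the
  -- two terms of Pascal's rule reduce to the pairs (a + 1, b) and (a, b + 1).
  qbinom-pochhammer : ∀ a b → qbinom (a + b) a ⊗ (pochhammer a ⊗ pochhammer b) ≈ pochhammer (a + b)
  qbinom-pochhammer zero b = ≈-trans (⊗-identityˡ _) (⊗-identityˡ _)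
  qbinom-pochhammer (suc a) zero rewrite ℕₚ.+-identityʳ a =
    ≈-trans (⊗-cong (qbinom-diagonal (suc a)) (⊗-identityʳ _)) (⊗-identityˡ _)
  qbinom-pochhammer (suc a) (suc b) = begin
    (u ⊗ qbinom (a + suc b) (suc a) ⊕ qbinom (a + suc b) a)
      ⊗ (pochhammer a ⊗ (oneₚ ⊝ u) ⊗ (pochhammer b ⊗ (oneₚ ⊝ v)))
      ≈⟨ Id.pascal-product u v _ _ _ _ ⟩
    u ⊗ (oneₚ ⊝ v) ⊗ (qbinom (a + suc b) (suc a) ⊗ (pochhammer (suc a) ⊗ pochhammer b))
      ⊕ (oneₚ ⊝ u) ⊗ (qbinom (a + suc b) a ⊗ (pochhammer a ⊗ pochhammer (suc b)))
      ≈⟨ ⊕-cong (⊗-congˡ shifted) (⊗-congˡ (qbinom-pochhammer a (suc b))) ⟩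
    u ⊗ (oneₚ ⊝ v) ⊗ pochhammer (a + suc b) ⊕ (oneₚ ⊝ u) ⊗ pochhammer (a + suc b)
      ≈⟨ Id.pascal-sum u v _ ⟩
    pochhammer (a + suc b) ⊗ (oneₚ ⊝ u ⊗ v)
      ≈⟨ ⊗-congˡ (⊕-congˡ (⊝-cong (≈-trans (≈-sym (q^-+ _ _)) (q^-cong (sym (ℕₚ.*-distribˡ-+ d (suc a) (suc b))))))) ⟩
    pochhammer (suc a + suc b) ∎
    where
    open SetoidReasoning setoid
    u v : PS
    u = q^ (d * suc a)
    v = q^ (d * suc b)
    shifted : qbinom (a + suc b) (suc a) ⊗ (pochhammer (suc a) ⊗ pochhammer b) ≈ pochhammer (a + suc b)
    shifted = subst (λ M → qbinom M (suc a) ⊗ (pochhammer (suc a) ⊗ pochhammer b) ≈ pochhammer M)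
      (sym (ℕₚ.+-suc a b)) (qbinom-pochhammer (suc a) b)

  -- The part of the product of q^A - q^(B + dm), m < M, in which N factors contribute their second
  -- monomial. The homogeneous form, with q^A in place of 1, keeps exponents natural when the
  -- product extends to both sides of a centre.
  cauchyTerm : ℕ → ℕ → ℕ → ℕ → PS
  cauchyTerm A M B N = σ N ⊗ (q^ (d * tri N + B * N + A * (M ∸ N)) ⊗ qbinom M N)

  -- Splitting off the factor m = 0 replaces `B` by `B + d` in the others. The two terms of Pascal's
  -- rule correspond to the two monomials of that factor.
  cauchyTerm-suc : ∀ A M B N → N ≤ M → cauchyTerm A (suc M) B (suc N)
    ≈ q^ A ⊗ cauchyTerm A M (B + d) (suc N) ⊝ q^ B ⊗ cauchyTerm A M (B + d) N
  cauchyTerm-suc A M B N N≤M =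
    Id.pascal-term (σ N) _ _ _ _ _ _ _ _ raised lowered
    where
    open SetoidReasoning setoid
    E E′ : ℕ
    E = d * tri (suc N) + B * suc N + A * (M ∸ N)
    E′ = d * tri N + (B + d) * N + A * (M ∸ N)
    raised : q^ A ⊗ (q^ (d * tri (suc N) + (B + d) * suc N + A * (M ∸ suc N)) ⊗ qbinom M (suc N))
      ≈ q^ E ⊗ q^ (d * suc N) ⊗ qbinom M (suc N)
    -- For N = M the truncated `M ∸ suc N` makes the two exponents differ by `A`, but
    -- `qbinom M (suc N)` vanishes there.
    raised with N ℕ.≟ M
    ... | yes refl = ≈-trans
      (≈-trans (⊗-congˡ (≈-trans (⊗-congˡ (qbinom-> N (suc N) ℕₚ.≤-refl)) (⊗-zeroʳ _))) (⊗-zeroʳ _))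
      (≈-sym (≈-trans (⊗-congˡ (qbinom-> N (suc N) ℕₚ.≤-refl)) (⊗-zeroʳ _)))
    ... | no N≢M = ≈-trans (≈-sym (⊗-assoc _ _ _)) (⊗-congʳ
      (≈-trans (≈-sym (q^-+ A _)) (≈-trans (q^-cong exponents) (q^-+ E (d * suc N)))))
      where
      go : ∀ A B d N t x → A + (d * t + (B + d) * suc N + A * x) ≡ d * t + B * suc N + A * suc x + d * suc N
      go = solve-∀
      exponents : A + (d * tri (suc N) + (B + d) * suc N + A * (M ∸ suc N)) ≡ E + d * suc N
      exponents = trans (go A B d N (tri (suc N)) (M ∸ suc N))
        (cong (λ x → d * tri (suc N) + B * suc N + A * x + d * suc N)
              (sym (ℕₚ.+-∸-assoc 1 (ℕₚ.≤∧≢⇒< N≤M N≢M))))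
    lowered : q^ B ⊗ (q^ E′ ⊗ qbinom M N) ≈ q^ E ⊗ qbinom M N
    lowered = ≈-trans (≈-sym (⊗-assoc _ _ _)) (⊗-congʳ (≈-trans (≈-sym (q^-+ B E′)) (q^-cong (go A B d N (tri N) (M ∸ N)))))
      where
      go : ∀ A B d N t x → B + (d * t + (B + d) * N + A * x) ≡ d * (t + N) + B * suc N + A * x
      go = solve-∀

  cauchy : ∀ A M B → ∏ (λ m → q^ A ⊝ q^ (B + d * m)) M ≈ Σ (cauchyTerm A M B) (suc M)
  cauchy A zero B = begin
    oneₚ                                                   ≈⟨ q^-zero ⟨
    q^ 0                                                   ≈⟨ q^-cong (go A B d) ⟩
    q^ (d * 0 + B * 0 + A * 0)                             ≈⟨ ≈-trans (⊗-identityˡ _) (⊗-identityʳ _) ⟨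
    oneₚ ⊗ (q^ (d * 0 + B * 0 + A * 0) ⊗ oneₚ)             ≈⟨ ⊕-identityˡ _ ⟨
    zeroₚ ⊕ oneₚ ⊗ (q^ (d * 0 + B * 0 + A * 0) ⊗ oneₚ)     ∎
    where
    open SetoidReasoning setoid
    go : ∀ A B d → 0 ≡ d * 0 + B * 0 + A * 0
    go = solve-∀
  cauchy A (suc M) B = begin
    ∏ (λ m → q^ A ⊝ q^ (B + d * m)) (suc M)
      ≈⟨ ∏-front (λ m → q^ A ⊝ q^ (B + d * m)) M ⟩
    (q^ A ⊝ q^ (B + d * 0)) ⊗ ∏ (λ m → q^ A ⊝ q^ (B + d * suc m)) M
      ≈⟨ ⊗-cong (⊕-congˡ (⊝-cong (q^-cong (go₀ B d))))
                (∏-cong M λ m _ → ⊕-congˡ (⊝-cong (q^-cong (go₁ B d m)))) ⟩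
    (q^ A ⊝ q^ B) ⊗ ∏ (λ m → q^ A ⊝ q^ (B + d + d * m)) M
      ≈⟨ ⊗-congˡ (cauchy A M (B + d)) ⟩
    (q^ A ⊝ q^ B) ⊗ Σ t (suc M)
      ≈⟨ Id.distribʳ-difference (q^ A) (q^ B) _ ⟩
    q^ A ⊗ Σ t (suc M) ⊝ q^ B ⊗ Σ t (suc M)
      -- The first sum is lengthened by the vanishing term N = M + 1, so that after its term N = 0
      -- is split off it has the same length as the second.
      ≈⟨ ⊕-cong (≈-trans (≈-sym (⊕-identityʳ _)) (⊕-cong (≈-sym (Σ-⊗ˡ _ _ (suc M))) (≈-sym beyond)))
                (≈-trans (⊝-cong (≈-sym (Σ-⊗ˡ _ _ (suc M)))) (≈-sym (Σ-neg _ (suc M)))) ⟩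
    Σ (λ N → q^ A ⊗ t N) (suc (suc M)) ⊕ Σ (λ N → neg (q^ B ⊗ t N)) (suc M)
      ≈⟨ ⊕-congʳ (Σ-front (λ N → q^ A ⊗ t N) (suc M)) ⟩
    q^ A ⊗ t 0 ⊕ Σ (λ N → q^ A ⊗ t (suc N)) (suc M) ⊕ Σ (λ N → neg (q^ B ⊗ t N)) (suc M)
      ≈⟨ ⊕-assoc _ _ _ ⟩
    q^ A ⊗ t 0 ⊕ (Σ (λ N → q^ A ⊗ t (suc N)) (suc M) ⊕ Σ (λ N → neg (q^ B ⊗ t N)) (suc M))
      ≈⟨ ⊕-cong first (≈-trans (≈-sym (Σ-⊕ _ _ (suc M)))
           (Σ-cong (suc M) λ N N<1+M → ≈-sym (cauchyTerm-suc A M B N (ℕₚ.≤-pred N<1+M)))) ⟩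
    cauchyTerm A (suc M) B 0 ⊕ Σ (cauchyTerm A (suc M) B ∘ suc) (suc M)
      ≈⟨ Σ-front (cauchyTerm A (suc M) B) (suc M) ⟨
    Σ (cauchyTerm A (suc M) B) (suc (suc M)) ∎
    where
    open SetoidReasoning setoid
    t : ℕ → PS
    t = cauchyTerm A M (B + d)
    go₀ : ∀ B d → B + d * 0 ≡ B
    go₀ = solve-∀
    go₁ : ∀ B d m → B + d * suc m ≡ B + d + d * m
    go₁ = solve-∀
    go₂ : ∀ A B d M → A + (d * 0 + (B + d) * 0 + A * M) ≡ d * 0 + B * 0 + A * suc M
    go₂ = solve-∀
    beyond : q^ A ⊗ t (suc M) ≈ zeroₚ
    beyond = ≈-trans (⊗-congˡ (≈-trans (⊗-congˡ (≈-trans (⊗-congˡ (qbinom-> M (suc M) ℕₚ.≤-refl)) (⊗-zeroʳ _))) (⊗-zeroʳ _))) (⊗-zeroʳ _)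
    first : q^ A ⊗ t 0 ≈ cauchyTerm A (suc M) B 0
    first = ≈-trans (Id.swap-in (q^ A) oneₚ _ oneₚ)
      (⊗-congˡ (⊗-congʳ (≈-trans (≈-sym (q^-+ A _)) (q^-cong (go₂ A B d M)))))

∏-q^ : ∀ e s → ∏ (λ _ → q^ e) s ≈ q^ (e * s)
∏-q^ e zero = ≈-trans (≈-sym q^-zero) (q^-cong (sym (ℕₚ.*-zeroʳ e)))
∏-q^ e (suc s) = ≈-trans (⊗-congʳ (∏-q^ e s))
  (≈-trans (≈-sym (q^-+ (e * s) e)) (q^-cong (trans (ℕₚ.+-comm (e * s) e) (sym (ℕₚ.*-suc e s)))))

∏-neg-q^ : ∀ b d s → ∏ (λ m → neg (q^ (b + d * m))) s ≈ σ s ⊗ q^ (b * s + d * tri s)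
∏-neg-q^ b d zero = ≈-trans (≈-sym q^-zero) (≈-trans (q^-cong (go b d)) (≈-sym (⊗-identityˡ _)))
  where
  go : ∀ b d → 0 ≡ b * 0 + d * 0
  go = solve-∀
∏-neg-q^ b d (suc s) = begin
  ∏ (λ m → neg (q^ (b + d * m))) s ⊗ neg (q^ (b + d * s))   ≈⟨ ⊗-congʳ (∏-neg-q^ b d s) ⟩
  σ s ⊗ q^ (b * s + d * tri s) ⊗ neg (q^ (b + d * s))       ≈⟨ Id.neg-product _ _ _ ⟩
  neg (σ s) ⊗ (q^ (b * s + d * tri s) ⊗ q^ (b + d * s))
    ≈⟨ ⊗-congˡ (≈-trans (≈-sym (q^-+ _ _)) (q^-cong (go b d s (tri s)))) ⟩
  neg (σ s) ⊗ q^ (b * suc s + d * (tri s + s))              ∎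
  where
  open SetoidReasoning setoid
  go : ∀ b d s t → b * s + d * t + (b + d * s) ≡ b * suc s + d * (t + s)
  go = solve-∀

σq^-cancel : ∀ s e {f g} → σ s ⊗ q^ e ⊗ f ≈ σ s ⊗ q^ e ⊗ g → f ≈ g
σq^-cancel s e {f} {g} h = q^-cancel e (begin
  q^ e ⊗ f                    ≈⟨ unsign f ⟨
  σ s ⊗ (σ s ⊗ q^ e ⊗ f)      ≈⟨ ⊗-congˡ h ⟩
  σ s ⊗ (σ s ⊗ q^ e ⊗ g)      ≈⟨ unsign g ⟩
  q^ e ⊗ g                    ∎)
  where
  open SetoidReasoning setoid
  unsign : ∀ f → σ s ⊗ (σ s ⊗ q^ e ⊗ f) ≈ q^ e ⊗ f
  unsign f = ≈-trans (Id.double (σ s) (q^ e) f) (≈-trans (⊗-congʳ (σ-square s)) (⊗-identityˡ _))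

-- Cauchy's product rearranged about its centre

module JacobiTriple (b c : ℕ) where

  d : ℕ
  d = b + c

  θ : ℕ → ℕ → PS
  θ e n = σ n ⊗ q^ (d * tri n + e * n)

  factors : ℕ → ℕ → PS
  factors e = ∏ (λ m → oneₚ ⊝ q^ (d * m + e))

  module _ (s : ℕ) where

    -- The exponent of the central term N = s: the factors m < s contribute b + dm each, the other s
    -- factors contribute ds each.
    base : ℕ
    base = b * s + d * tri s + d * s * s

    product : ∏ (λ m → q^ (d * s) ⊝ q^ (b + d * m)) (s + s) ≈ σ s ⊗ q^ base ⊗ (factors c s ⊗ factors b s)
    product = begin
      ∏ f (s + s)
        ≈⟨ ∏-split f s s ⟩
      ∏ f s ⊗ ∏ (λ m → f (s + m)) s
        ≈⟨ ⊗-cong low high ⟩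
      σ s ⊗ q^ (b * s + d * tri s) ⊗ factors c s ⊗ (q^ (d * s * s) ⊗ factors b s)
        ≈⟨ Id.collect _ _ _ _ _ ⟩
      σ s ⊗ (q^ (b * s + d * tri s) ⊗ q^ (d * s * s)) ⊗ (factors c s ⊗ factors b s)
        ≈⟨ ⊗-congʳ (⊗-congˡ (q^-+ _ _)) ⟨
      σ s ⊗ q^ base ⊗ (factors c s ⊗ factors b s) ∎
      where
      open SetoidReasoning setoid
      f g : ℕ → PS
      f m = q^ (d * s) ⊝ q^ (b + d * m)
      g m = neg (q^ (b + d * m))
      -- Counted down from the centre, ds exceeds b + d(s - 1 - m) by dm + (d - b), and d - b is
      -- `c`.
      low-factor : ∀ m → m < s → f (s ∸ suc m) ≈ g (s ∸ suc m) ⊗ (oneₚ ⊝ q^ (d * m + c))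
      low-factor m m<s = ≈-trans
        (⊕-congʳ (≈-trans (q^-cong (trans (cong (d *_) (sym (ℕₚ.m+[n∸m]≡n m<s))) (go b c m (s ∸ suc m)))) (q^-+ _ _)))
        (Id.product-of-difference _ _)
        where
        go : ∀ b c m t → (b + c) * (suc m + t) ≡ b + (b + c) * t + ((b + c) * m + c)
        go = solve-∀
      low : ∏ f s ≈ σ s ⊗ q^ (b * s + d * tri s) ⊗ factors c s
      low = begin
        ∏ f s                                         ≈⟨ ∏-reverse f s ⟩
        ∏ (λ m → f (s ∸ suc m)) s                     ≈⟨ ∏-cong s low-factor ⟩
        ∏ (λ m → g (s ∸ suc m) ⊗ (oneₚ ⊝ q^ (d * m + c))) s
                                                      ≈⟨ ∏-⊗ _ _ s ⟩
        ∏ (λ m → g (s ∸ suc m)) s ⊗ factors c s       ≈⟨ ⊗-congʳ (∏-reverse g s) ⟨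
        ∏ g s ⊗ factors c s                           ≈⟨ ⊗-congʳ (∏-neg-q^ b d s) ⟩
        σ s ⊗ q^ (b * s + d * tri s) ⊗ factors c s    ∎
      high : ∏ (λ m → f (s + m)) s ≈ q^ (d * s * s) ⊗ factors b s
      high = ≈-trans (∏-cong s λ m _ → ≈-trans
          (⊕-congˡ (⊝-cong (≈-trans (q^-cong (go b d s m)) (q^-+ _ _)))) (Id.difference-of-product _ _))
        (≈-trans (∏-⊗ _ _ s) (⊗-congʳ (∏-q^ (d * s) s)))
        where
        go : ∀ b d s m → b + d * (s + m) ≡ d * s + (d * m + b)
        go = solve-∀

    term-right : ∀ n → n ≤ s → cauchyTerm d (d * s) (s + s) b (s + n)
      ≈ σ s ⊗ q^ base ⊗ (θ b n ⊗ qbinom d (s + s) (s + n))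
    term-right n n≤s = ≈-trans (⊗-cong (σ-+ s n) (⊗-congʳ (≈-trans (q^-cong exponents) (q^-+ base _))))
      (Id.regroup _ _ _ _ _)
      where
      go : ∀ b d s n x t u → s ≡ n + x →
        d * (t + u + s * n) + b * (s + n) + d * s * x ≡ b * s + d * t + d * s * s + (d * u + b * n)
      go b d s n x t u s≡ = trans (go₁ b d s n x t u) (cong (λ y → b * s + d * t + d * s * y + (d * u + b * n)) (sym s≡))
        where
        go₁ : ∀ b d s n x t u →
          d * (t + u + s * n) + b * (s + n) + d * s * x ≡ b * s + d * t + d * s * (n + x) + (d * u + b * n)
        go₁ = solve-∀
      exponents : d * tri (s + n) + b * (s + n) + d * s * (s + s ∸ (s + n)) ≡ base + (d * tri n + b * n)
      exponents rewrite tri-+ s n | ℕₚ.[m+n]∸[m+o]≡n∸o s s n =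
        go b d s n (s ∸ n) (tri s) (tri n) (sym (ℕₚ.m+[n∸m]≡n n≤s))

    -- Formally this is `θ b` at the index -m: the binomial coefficient of -m over 2 is `tri m + m`,
    -- and d - b = c, so the exponent becomes that of `θ c` at m. `tri-square` carries this out
    -- without negative numbers.
    term-left : ∀ m → m ≤ s → cauchyTerm d (d * s) (s + s) b (s ∸ m)
      ≈ σ s ⊗ q^ base ⊗ (θ c m ⊗ qbinom d (s + s) (s ∸ m))
    term-left m m≤s = ≈-trans (⊗-cong sign (⊗-congʳ (≈-trans (q^-cong exponents) (q^-+ base _))))
      (Id.regroup _ _ _ _ _)
      where
      N : ℕ
      N = s ∸ m
      s≡ : s ≡ m + N
      s≡ = sym (ℕₚ.m+[n∸m]≡n m≤s)
      sign : σ N ≈ σ s ⊗ σ m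
      sign = begin
        σ N                  ≈⟨ ⊗-identityˡ _ ⟨
        oneₚ ⊗ σ N           ≈⟨ ⊗-congʳ (σ-square m) ⟨
        σ m ⊗ σ m ⊗ σ N      ≈⟨ ≈-trans (⊗-assoc _ _ _) (⊗-comm _ _) ⟩
        σ m ⊗ σ N ⊗ σ m      ≈⟨ ⊗-congʳ (σ-+ m N) ⟨
        σ (m + N) ⊗ σ m      ≡⟨ cong (λ x → σ x ⊗ σ m) (sym s≡) ⟩
        σ s ⊗ σ m            ∎
        where open SetoidReasoning setoid
      go : ∀ b c m N t u → t + t + m ≡ m * m →
        (b + c) * u + b * N + (b + c) * (m + N) * (m + N + m)
        ≡ b * (m + N) + (b + c) * (t + u + m * N) + (b + c) * (m + N) * (m + N) + ((b + c) * t + c * m)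
      go b c m N t u t≡ = trans (go₁ b c m N u) (trans (cong (λ y → X + (b + c) * y) (sym t≡)) (go₂ b c m N t u))
        where
        X : ℕ
        X = (b + c) * u + b * N + (b + c) * (m + N) * (m + N) + (b + c) * N * m
        go₁ : ∀ b c m N u → (b + c) * u + b * N + (b + c) * (m + N) * (m + N + m)
          ≡ (b + c) * u + b * N + (b + c) * (m + N) * (m + N) + (b + c) * N * m + (b + c) * (m * m)
        go₁ = solve-∀
        go₂ : ∀ b c m N t u →
          (b + c) * u + b * N + (b + c) * (m + N) * (m + N) + (b + c) * N * m + (b + c) * (t + t + m)
          ≡ b * (m + N) + (b + c) * (t + u + m * N) + (b + c) * (m + N) * (m + N) + ((b + c) * t + c * m)
        go₂ = solve-∀
      exponents : d * tri N + b * N + d * s * (s + s ∸ N) ≡ base + (d * tri m + c * m)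
      exponents = begin
        d * tri N + b * N + d * s * (s + s ∸ N)
          ≡⟨ cong (λ x → d * tri N + b * N + d * s * x) (trans (ℕₚ.+-∸-assoc s (ℕₚ.m∸n≤m s m)) (cong (λ x → s + x) (ℕₚ.m∸[m∸n]≡n m≤s))) ⟩
        d * tri N + b * N + d * s * (s + m)
          ≡⟨ cong (λ x → d * tri N + b * N + d * x * (x + m)) s≡ ⟩
        d * tri N + b * N + d * (m + N) * (m + N + m)
          ≡⟨ go b c m N (tri m) (tri N) (tri-square m) ⟩
        b * (m + N) + d * (tri m + tri N + m * N) + d * (m + N) * (m + N) + (d * tri m + c * m)
          ≡⟨ cong (λ x → b * (m + N) + d * x + d * (m + N) * (m + N) + (d * tri m + c * m)) (sym (tri-+ m N)) ⟩
        b * (m + N) + d * tri (m + N) + d * (m + N) * (m + N) + (d * tri m + c * m)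
          ≡⟨ cong (λ x → b * x + d * tri x + d * x * x + (d * tri m + c * m)) (sym s≡) ⟩
        base + (d * tri m + c * m) ∎
        where open ≡.≡-Reasoning

    finite-jacobi : factors c s ⊗ factors b s
      ≈ Σ (λ n → θ c (suc n) ⊗ qbinom d (s + s) (s ∸ suc n)) s ⊕ Σ (λ n → θ b n ⊗ qbinom d (s + s) (s + n)) (suc s)
    finite-jacobi = σq^-cancel s base (begin
      σ s ⊗ q^ base ⊗ (factors c s ⊗ factors b s)
        ≈⟨ product ⟨
      ∏ (λ m → q^ (d * s) ⊝ q^ (b + d * m)) (s + s)
        ≈⟨ cauchy d (d * s) (s + s) b ⟩
      Σ t (suc (s + s))
        -- There are 2s + 1 terms; the central one N = s goes to the right half, and the left half
        -- starts at distance 1.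
        ≡⟨ cong (Σ t) (sym (ℕₚ.+-suc s s)) ⟩
      Σ t (s + suc s)
        ≈⟨ Σ-split t s (suc s) ⟩
      Σ t s ⊕ Σ (λ n → t (s + n)) (suc s)
        ≈⟨ ⊕-cong (≈-trans (Σ-reverse t s) (Σ-cong s λ n → term-left (suc n)))
                  (Σ-cong (suc s) λ n n<1+s → term-right n (ℕₚ.≤-pred n<1+s)) ⟩
      Σ (λ n → σ s ⊗ q^ base ⊗ (θ c (suc n) ⊗ qbinom d (s + s) (s ∸ suc n))) s
        ⊕ Σ (λ n → σ s ⊗ q^ base ⊗ (θ b n ⊗ qbinom d (s + s) (s + n))) (suc s)
        ≈⟨ ⊕-cong (Σ-⊗ˡ _ _ s) (Σ-⊗ˡ _ _ (suc s)) ⟩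
      σ s ⊗ q^ base ⊗ Σ (λ n → θ c (suc n) ⊗ qbinom d (s + s) (s ∸ suc n)) s
        ⊕ σ s ⊗ q^ base ⊗ Σ (λ n → θ b n ⊗ qbinom d (s + s) (s + n)) (suc s)
        ≈⟨ ⊗-distribˡ _ _ _ ⟨
      σ s ⊗ q^ base ⊗ (Σ (λ n → θ c (suc n) ⊗ qbinom d (s + s) (s ∸ suc n)) s
        ⊕ Σ (λ n → θ b n ⊗ qbinom d (s + s) (s + n)) (suc s)) ∎)
      where
      open SetoidReasoning setoid
      t : ℕ → PS
      t = cauchyTerm d (d * s) (s + s) b

-- The triple product as a product over residue classes

1-q^-inverse : ∀ e → (oneₚ ⊝ q^ (suc e)) ⊗ geom (mono (suc e)) ≈ oneₚ
1-q^-inverse e = ≈-trans (⊗-congʳ (⊕-congˡ (⊝-cong (≈-sym (mono≈q^ (suc e)))))) (geom-inverse refl)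

1-q^≈1 : ∀ {K e} → K ≤ e → oneₚ ⊝ q^ e ≈[ K ] oneₚ
1-q^≈1 {K} {e} K≤e = ≈ₜ-trans (⊝-congₜ ≈ₜ-refl (≈ₜ-weaken K≤e (q^-order e))) (≈⇒≈ₜ (⊝-zero oneₚ))

geom≈1 : ∀ e → geom (mono (suc e)) ≈[ suc e ] oneₚ
geom≈1 e = ≈ₜ-trans (≈ₜ-sym (≈⇒≈ₜ (⊗-identityˡ _)))
  (≈ₜ-trans (⊗-congₜʳ (≈ₜ-sym (1-q^≈1 {suc e} ℕₚ.≤-refl))) (≈⇒≈ₜ (1-q^-inverse e)))

-- The limit of the finite triple product

module _ (d : ℕ) where

  pochhammer-stable : ∀ {K a b} → K ≤ suc a → K ≤ suc b → pochhammer (suc d) a ≈[ K ] pochhammer (suc d) b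
  pochhammer-stable {zero} _ _ = mkₜ λ _ ()
  pochhammer-stable {suc K} {a} {b} (s≤s K≤a) (s≤s K≤b) = ≈ₜ-trans (to-K K≤a) (≈ₜ-sym (to-K K≤b))
    where
    to-K : ∀ {x} → K ≤ x → pochhammer (suc d) x ≈[ suc K ] pochhammer (suc d) K
    to-K {x} K≤x = subst (λ y → pochhammer (suc d) y ≈[ suc K ] pochhammer (suc d) K) (ℕₚ.m+[n∸m]≡n K≤x)
      (∏-stable (λ m → 1-q^≈1 (ℕₚ.m≤n*m (suc m) (suc d))) K (x ∸ K))

  pochhammer⁻¹ : ℕ → PS
  pochhammer⁻¹ = ∏ (λ m → geom (mono (suc d * suc m)))

  pochhammer-inverse : ∀ n → pochhammer (suc d) n ⊗ pochhammer⁻¹ n ≈ oneₚ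
  pochhammer-inverse n = ≈-trans (≈-sym (∏-⊗ _ _ n)) (∏-one n λ m _ → 1-q^-inverse (m + d * suc m))

  -- Modulo q^K all sufficiently long pochhammer products agree. In the factorial formula
  -- `pochhammer s` may thus stand for `pochhammer b`, and the invertible `pochhammer a` cancels.
  qbinom-limit : ∀ {K} a b s → K ≤ suc a → K ≤ suc b → K ≤ suc s →
    qbinom (suc d) (a + b) a ⊗ pochhammer (suc d) s ≈[ K ] oneₚ
  qbinom-limit {K} a b s K≤a K≤b K≤s = unit-cancelₜ (pochhammer-inverse a) (begin
    qbinom (suc d) (a + b) a ⊗ pochhammer (suc d) s ⊗ pochhammer (suc d) a
      ≈⟨ ≈⇒≈ₜ (≈-trans (⊗-assoc _ _ _) (⊗-congˡ (⊗-comm _ _))) ⟩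
    qbinom (suc d) (a + b) a ⊗ (pochhammer (suc d) a ⊗ pochhammer (suc d) s)
      ≈⟨ ⊗-congₜˡ _ (⊗-congₜˡ _ (pochhammer-stable K≤s K≤b)) ⟩
    qbinom (suc d) (a + b) a ⊗ (pochhammer (suc d) a ⊗ pochhammer (suc d) b)
      ≈⟨ ≈⇒≈ₜ (qbinom-pochhammer (suc d) a b) ⟩
    pochhammer (suc d) (a + b)
      ≈⟨ pochhammer-stable (ℕₚ.≤-trans K≤a (s≤s (ℕₚ.m≤m+n a b))) K≤a ⟩
    pochhammer (suc d) a ∎)
    where open SetoidReasoning (truncSetoid {K})

module Theta (b′ c′ : ℕ) where

  open JacobiTriple (suc b′) (suc c′)

  -- Towards the ends of the range the q-binomial coefficient approaches its limit only to order s -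
  -- n + 1. The exponent of θ is at least n and makes up the difference.
  θ-absorb : ∀ e n {f s} → n ≤ s → f ≈[ suc (s ∸ n) ] oneₚ → θ (suc e) n ⊗ f ≈[ suc s ] θ (suc e) n
  θ-absorb e n {f} {s} n≤s h = begin
    θ (suc e) n ⊗ f           ≈⟨ ≈⇒≈ₜ (⊗-assoc _ _ _) ⟩
    σ n ⊗ (q^ E ⊗ f)          ≈⟨ ⊗-congₜˡ _ (≈ₜ-weaken bound (q^-⊗-congₜ E h)) ⟩
    σ n ⊗ (q^ E ⊗ oneₚ)       ≈⟨ ≈⇒≈ₜ (⊗-congˡ (⊗-identityʳ _)) ⟩
    θ (suc e) n               ∎
    where
    open SetoidReasoning (truncSetoid {suc s})
    E : ℕ
    E = d * tri n + suc e * n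
    bound : suc s ≤ E + suc (s ∸ n)
    bound = ℕₚ.≤-trans (ℕₚ.≤-reflexive (trans (cong suc (sym (ℕₚ.m+[n∸m]≡n n≤s))) (sym (ℕₚ.+-suc n (s ∸ n)))))
      (ℕₚ.+-monoˡ-≤ (suc (s ∸ n)) (ℕₚ.≤-trans (ℕₚ.m≤n*m n (suc e)) (ℕₚ.m≤n+m (suc e * n) (d * tri n))))

  θ-order : ∀ e n → θ (suc e) n ≈[ n ] zeroₚ
  θ-order e n = ≈ₜ-trans (≈⇒≈ₜ (⊗-comm _ _))
    (⊗-orderₜˡ _ (≈ₜ-weaken (ℕₚ.≤-trans (ℕₚ.m≤n*m n (suc e)) (ℕₚ.m≤n+m (suc e * n) (d * tri n))) (q^-order _)))

  jacobi : ∀ s → factors (suc c′) s ⊗ factors (suc b′) s ⊗ pochhammer d s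
    ≈[ suc s ] Σ (λ n → θ (suc c′) (suc n)) s ⊕ Σ (θ (suc b′)) (suc s)
  jacobi s = begin
    factors (suc c′) s ⊗ factors (suc b′) s ⊗ pochhammer d s
      ≈⟨ ≈⇒≈ₜ (≈-trans (⊗-congʳ (finite-jacobi s)) (⊗-comm _ _)) ⟩
    pochhammer d s ⊗ (Σ left s ⊕ Σ right (suc s))
      ≈⟨ ≈⇒≈ₜ (≈-trans (⊗-distribˡ _ _ _) (⊕-cong (≈-sym (Σ-⊗ˡ _ _ s)) (≈-sym (Σ-⊗ˡ _ _ (suc s))))) ⟩
    Σ (λ n → pochhammer d s ⊗ left n) s ⊕ Σ (λ n → pochhammer d s ⊗ right n) (suc s)
      ≈⟨ ⊕-congₜ (Σ-congₜ s λ n → left-limit n) (Σ-congₜ (suc s) λ n n<1+s → right-limit n (ℕₚ.≤-pred n<1+s)) ⟩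
    Σ (λ n → θ (suc c′) (suc n)) s ⊕ Σ (θ (suc b′)) (suc s) ∎
    where
    open SetoidReasoning (truncSetoid {suc s})
    left right : ℕ → PS
    left n = θ (suc c′) (suc n) ⊗ qbinom d (s + s) (s ∸ suc n)
    right n = θ (suc b′) n ⊗ qbinom d (s + s) (s + n)
    move : ∀ x f g → x ⊗ (f ⊗ g) ≈ f ⊗ (g ⊗ x)
    move x f g = ≈-trans (⊗-comm x (f ⊗ g)) (⊗-assoc f g x)
    left-limit : ∀ n → n < s → pochhammer d s ⊗ left n ≈[ suc s ] θ (suc c′) (suc n)
    left-limit n n<s = ≈ₜ-trans (≈⇒≈ₜ (move _ _ _)) (θ-absorb c′ (suc n) n<s
      (subst (λ M → qbinom d M a ⊗ pochhammer d s ≈[ suc a ] oneₚ) a+b≡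
        (qbinom-limit (b′ + suc c′) a (s + suc n) s ℕₚ.≤-refl
          (s≤s (ℕₚ.≤-trans (ℕₚ.m∸n≤m s (suc n)) (ℕₚ.m≤m+n s (suc n)))) (s≤s (ℕₚ.m∸n≤m s (suc n))))))
      where
      a : ℕ
      a = s ∸ suc n
      a+b≡ : a + (s + suc n) ≡ s + s
      a+b≡ = trans (ℕₚ.+-comm a (s + suc n)) (trans (ℕₚ.+-assoc s (suc n) a) (cong (λ x → s + x) (ℕₚ.m+[n∸m]≡n n<s)))
    right-limit : ∀ n → n ≤ s → pochhammer d s ⊗ right n ≈[ suc s ] θ (suc b′) n
    right-limit n n≤s = ≈ₜ-trans (≈⇒≈ₜ (move _ _ _)) (θ-absorb b′ n n≤s
      (subst (λ M → qbinom d M (s + n) ⊗ pochhammer d s ≈[ suc (s ∸ n) ] oneₚ) a+b≡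
        (qbinom-limit (b′ + suc c′) (s + n) (s ∸ n) s
          (s≤s (ℕₚ.≤-trans (ℕₚ.m∸n≤m s n) (ℕₚ.m≤m+n s n))) ℕₚ.≤-refl (s≤s (ℕₚ.m∸n≤m s n)))))
      where
      a+b≡ : s + n + (s ∸ n) ≡ s + s
      a+b≡ = trans (ℕₚ.+-assoc s n (s ∸ n)) (cong (λ x → s + x) (ℕₚ.m+[n∸m]≡n n≤s))

-- Residue classes and the cancellation between the factors of F and G

≡ᵇ-true : ∀ m n → (m ≡ᵇ n) ≡ true → m ≡ n
≡ᵇ-true m n h = ℕₚ.≡ᵇ⇒≡ m n (subst T (sym h) _)

≡ᵇ-false : ∀ {m n} → m ≢ n → (m ≡ᵇ n) ≡ false
≡ᵇ-false {m} {n} m≢n with m ≡ᵇ n in eq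
... | false = refl
... | true = contradiction (≡ᵇ-true m n eq) m≢n

≡ᵇ-refl : ∀ n → (n ≡ᵇ n) ≡ true
≡ᵇ-refl zero = refl
≡ᵇ-refl (suc n) = ≡ᵇ-refl n

suc-% : ∀ d u → u < suc d → (suc u < suc d × suc u % suc d ≡ suc u) ⊎ (u ≡ d × suc u % suc d ≡ 0)
suc-% d u (s≤s u≤d) with u ℕ.≟ d
... | yes refl = inj₂ (refl , n%n≡0 (suc d))
... | no u≢d = inj₁ (1+u<1+d , m<n⇒m%n≡m 1+u<1+d)
  where
  1+u<1+d : suc u < suc d
  1+u<1+d = s≤s (ℕₚ.≤∧≢⇒< u≤d u≢d)

suc-%-injective : ∀ d {u v} → u < suc d → v < suc d → suc u % suc d ≡ suc v % suc d → u ≡ v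
suc-%-injective d {u} {v} u<d v<d h with suc-% d u u<d | suc-% d v v<d
... | inj₁ (_ , p) | inj₁ (_ , r) = ℕₚ.suc-injective (trans (sym p) (trans h r))
... | inj₁ (_ , p) | inj₂ (_ , r) = contradiction (trans (sym p) (trans h r)) λ ()
... | inj₂ (_ , p) | inj₁ (_ , r) = contradiction (trans (sym r) (trans (sym h) p)) λ ()
... | inj₂ (p , _) | inj₂ (r , _) = trans p (sym r)

module Residue (d : ℕ) where

  restrict : ℕ → ℕ → PS
  restrict ρ m = if m % suc d ≡ᵇ ρ then oneₚ ⊝ q^ m else oneₚ

  -- Any `suc d` consecutive numbers meet each residue class once. Blocks start at 1, so position
  -- `v` has the residue of `suc v`, and class 0 is met at the last position v = d.
  ∏-restrict-block : ∀ v t → v < suc d →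
    ∏ (λ u → restrict (suc v % suc d) (suc (t * suc d + u))) (suc d) ≈ oneₚ ⊝ q^ (suc (t * suc d + v))
  ∏-restrict-block v t v<d = ≈-trans (∏-single f v (suc d) v<d others) (≡⇒≈ at-v)
    where
    f : ℕ → PS
    f u = restrict (suc v % suc d) (suc (t * suc d + u))
    ≡⇒≈ : ∀ {x y} → x ≡ y → x ≈ y
    ≡⇒≈ refl = ≈-refl
    mod : ∀ u → suc (t * suc d + u) % suc d ≡ suc u % suc d
    mod u = trans (cong (λ x → suc x % suc d) (ℕₚ.+-comm (t * suc d) u)) ([m+kn]%n≡m%n (suc u) t (suc d))
    others : ∀ u → u < suc d → u ≢ v → f u ≈ oneₚ
    others u u<d u≢v = ≡⇒≈ (cong (λ x → if x then oneₚ ⊝ q^ (suc (t * suc d + u)) else oneₚ)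
      (≡ᵇ-false λ h → u≢v (suc-%-injective d u<d v<d (trans (sym (mod u)) h))))
    at-v : f v ≡ oneₚ ⊝ q^ (suc (t * suc d + v))
    at-v = cong (λ x → if x then oneₚ ⊝ q^ (suc (t * suc d + v)) else oneₚ)
      (trans (cong (_≡ᵇ suc v % suc d) (mod v)) (≡ᵇ-refl (suc v % suc d)))

  ∏-restrict : ∀ v s → v < suc d →
    ∏ (λ m → restrict (suc v % suc d) (suc m)) (s * suc d) ≈ ∏ (λ t → oneₚ ⊝ q^ (suc (t * suc d + v))) s
  ∏-restrict v s v<d = ≈-trans (∏-blocks (λ m → restrict (suc v % suc d) (suc m)) (suc d) s)
    (∏-cong s λ t _ → ∏-restrict-block v t v<d)

if-≈ₜ-one : ∀ {K f} x → f ≈[ K ] oneₚ → (if x then f else oneₚ) ≈[ K ] oneₚ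
if-≈ₜ-one true h = h
if-≈ₜ-one false _ = ≈ₜ-refl

-- F has the factor 1 - q^m unless m ≡ 2 mod 4, and G cancels it unless m lies in one of three
-- classes. The exclusions keep these classes apart from one another and from 2 mod 4, so each
-- surviving factor appears exactly once on the right.
select : ∀ {f f⁻¹ f′} x p₀ p₁ p₂ → f′ ≈ f → f ⊗ f⁻¹ ≈ oneₚ →
  (x ≡ true → p₀ ≡ true → ⊥) → (x ≡ true → p₁ ≡ true → ⊥) → (x ≡ true → p₂ ≡ true → ⊥) →
  (p₀ ≡ true → p₁ ≡ true → ⊥) → (p₀ ≡ true → p₂ ≡ true → ⊥) → (p₁ ≡ true → p₂ ≡ true → ⊥) →
  (if not x then f′ else oneₚ) ⊗ (if not x ∧ (not p₀ ∧ (not p₁ ∧ not p₂)) then f⁻¹ else oneₚ)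
  ≈ (if p₀ then f else oneₚ) ⊗ ((if p₁ then f else oneₚ) ⊗ (if p₂ then f else oneₚ))
select true true _ _ _ _ h _ _ _ _ _ = ⊥-elim (h refl refl)
select true false true _ _ _ _ h _ _ _ _ = ⊥-elim (h refl refl)
select true false false true _ _ _ _ h _ _ _ = ⊥-elim (h refl refl)
select true false false false _ _ _ _ _ _ _ _ = ⊗-congˡ (≈-sym (⊗-identityˡ oneₚ))
select false true true _ _ _ _ _ _ h _ _ = ⊥-elim (h refl refl)
select false true false true _ _ _ _ _ _ h _ = ⊥-elim (h refl refl)
select false false true true _ _ _ _ _ _ _ h = ⊥-elim (h refl refl)
select false true false false f≈ _ _ _ _ _ _ _ = ⊗-cong f≈ (≈-sym (⊗-identityˡ oneₚ))
select false false true false f≈ _ _ _ _ _ _ _ = ≈-trans (⊗-cong f≈ ≈-refl) (≈-sym (⊗-identityˡ _))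
select false false false true f≈ _ _ _ _ _ _ _ =
  ≈-trans (⊗-identityʳ _) (≈-trans f≈ (≈-sym (≈-trans (⊗-identityˡ _) (⊗-identityˡ _))))
select false false false false f≈ inv _ _ _ _ _ _ =
  ≈-trans (⊗-congʳ f≈) (≈-trans inv (≈-sym (≈-trans (⊗-identityˡ _) (⊗-identityˡ _))))

-- The product formula on the initial shelf

module Base (i r : ℕ) where

  k b′ c′ d′ : ℕ
  k = suc i + r
  b′ = 2 * k + 2 * i
  c′ = 2 * r
  -- In this form `4 * k` computes to `suc d′`, and so `modN m (4 * k)` to `m % suc d′`.
  d′ = i + r + 3 * k

  -- The paper's index is i + 1, so that suc b′ and suc c′ are the residues
  -- 2k ± (2(i + 1) - 1), and suc d′ is 4k.
  open JacobiTriple (suc b′) (suc c′)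
  open Theta b′ c′
  open Residue d′

  d≡ : d ≡ suc d′
  d≡ = go i r
    where
    go : ∀ i r → suc (2 * (suc i + r) + 2 * i) + suc (2 * r) ≡ suc (i + r + 3 * (suc i + r))
    go = solve-∀

  b<d : suc b′ < suc d′
  b<d = ℕₚ.<-≤-trans (ℕₚ.m<m+n (suc b′) (s≤s z≤n)) (ℕₚ.≤-reflexive d≡)

  c<d : suc c′ < suc d′
  c<d = ℕₚ.<-≤-trans (ℕₚ.m<n+m (suc c′) {suc b′} (s≤s z≤n)) (ℕₚ.≤-reflexive d≡)

  c<b : suc c′ < suc b′
  c<b = ℕₚ.≤-trans (ℕₚ.m<m+n (suc c′) (s≤s z≤n)) (ℕₚ.≤-reflexive (go i r))
    where
    go : ∀ i r → suc (2 * r) + suc (1 + 4 * i) ≡ suc (2 * (suc i + r) + 2 * i)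
    go = solve-∀

  parity : ∀ x → suc (2 * x) % 2 ≡ 1
  parity x = trans (cong (λ y → suc y % 2) (ℕₚ.*-comm 2 x)) ([m+kn]%n≡m%n 1 x 2)

  -- As 4 divides 4k, reduction modulo 4k preserves the class modulo 4; neither 0 nor an odd residue
  -- lies in the class 2.
  ¬2mod4 : ∀ {m ρ} → m % 4 ≡ 2 → m % suc d′ ≡ ρ → (ρ ≡ 0) ⊎ (ρ % 2 ≡ 1) → ⊥
  ¬2mod4 {m} {ρ} m≡2 m≡ρ ρ-cases = cases ρ-cases
    where
    ρ%4≡2 : ρ % 4 ≡ 2
    ρ%4≡2 = trans (cong (_% 4) (sym m≡ρ)) (trans (m∣n⇒o%n%m≡o%m 4 (suc d′) m (m∣m*n k)) m≡2)
    cases : (ρ ≡ 0) ⊎ (ρ % 2 ≡ 1) → ⊥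
    cases (inj₁ refl) = contradiction ρ%4≡2 λ ()
    cases (inj₂ odd) = contradiction
      (trans (sym odd) (trans (sym (m∣n⇒o%n%m≡o%m 2 4 ρ (divides 2 refl))) (cong (_% 2) ρ%4≡2))) λ ()

  b-odd : suc b′ % 2 ≡ 1
  b-odd = trans (cong (λ x → suc x % 2) (sym (ℕₚ.*-distribˡ-+ 2 k i))) (parity (k + i))

  F-factor G-factor : ℕ → PS
  F-factor m = if not (modN m 4 ≡ᵇ 2) then oneₚ -ₚ mono m else oneₚ
  G-factor m = if inG k (suc i) m then geom (mono m) else oneₚ

  residue₊ : modN (2 * k + (2 * suc i ∸ 1)) (4 * k) ≡ suc b′
  residue₊ = trans (cong (_% suc d′) (trans (cong (λ x → 2 * k + x) (go i)) (ℕₚ.+-suc (2 * k) (2 * i)))) (m<n⇒m%n≡m b<d)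
    where
    go : ∀ i → i + suc (i + 0) ≡ suc (2 * i)
    go = solve-∀

  residue₋ : modN (2 * k ∸ (2 * suc i ∸ 1)) (4 * k) ≡ suc c′
  residue₋ = trans (cong (_% suc d′) (trans (cong (_∸ (2 * suc i ∸ 1)) (go i r)) (ℕₚ.m+n∸m≡n (2 * suc i ∸ 1) (suc c′)))) (m<n⇒m%n≡m c<d)
    where
    go : ∀ i r → 2 * (suc i + r) ≡ i + suc (i + 0) + suc (2 * r)
    go = solve-∀

  factor-product : ∀ m → F-factor (suc m) ⊗ G-factor (suc m)
    ≈ restrict 0 (suc m) ⊗ (restrict (suc b′) (suc m) ⊗ restrict (suc c′) (suc m))
  factor-product m rewrite residue₊ | residue₋ =
    select (suc m % 4 ≡ᵇ 2) (ϱ ≡ᵇ 0) (ϱ ≡ᵇ suc b′) (ϱ ≡ᵇ suc c′) (1-mono (suc m)) (1-q^-inverse m)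
      (λ x p → ¬2mod4 {suc m} (≡ᵇ-true _ 2 x) (≡ᵇ-true ϱ _ p) (inj₁ refl))
      (λ x p → ¬2mod4 {suc m} (≡ᵇ-true _ 2 x) (≡ᵇ-true ϱ _ p) (inj₂ b-odd))
      (λ x p → ¬2mod4 {suc m} (≡ᵇ-true _ 2 x) (≡ᵇ-true ϱ _ p) (inj₂ (parity r)))
      (λ p p′ → contradiction (trans (sym (≡ᵇ-true ϱ 0 p)) (≡ᵇ-true ϱ (suc _) p′)) λ ())
      (λ p p′ → contradiction (trans (sym (≡ᵇ-true ϱ 0 p)) (≡ᵇ-true ϱ (suc _) p′)) λ ())
      (λ p p′ → contradiction (trans (sym (≡ᵇ-true ϱ (suc b′) p)) (≡ᵇ-true ϱ (suc c′) p′)) (ℕₚ.<⇒≢ c<b ∘ sym))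
    where
    ϱ : ℕ
    ϱ = suc m % suc d′

  F⊗Gbase : ∀ s → F ⊗ Gbase k (suc i) ≈[ suc s ] factors (suc c′) s ⊗ factors (suc b′) s ⊗ pochhammer d s
  F⊗Gbase s = begin
    F ⊗ Gbase k (suc i)
      -- Both products are cut off after `s` complete blocks of length 4k, far beyond the required
      -- precision, so that each residue class contributes exactly `s` factors.
      ≈⟨ ⊗-congₜ (truncate {F-factor} F-near) (truncate {G-factor} G-near) ⟩
    ∏ (F-factor ∘ suc) (s * suc d′) ⊗ ∏ (G-factor ∘ suc) (s * suc d′)
      ≈⟨ ≈⇒≈ₜ (≈-trans (≈-sym (∏-⊗ _ _ (s * suc d′))) (∏-cong (s * suc d′) λ m _ → factor-product m)) ⟩
    ∏ (λ m → restrict 0 (suc m) ⊗ (restrict (suc b′) (suc m) ⊗ restrict (suc c′) (suc m))) (s * suc d′)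
      ≈⟨ ≈⇒≈ₜ (≈-trans (∏-⊗ _ _ (s * suc d′)) (⊗-congˡ (∏-⊗ _ _ (s * suc d′)))) ⟩
    ∏ (restrict 0 ∘ suc) (s * suc d′) ⊗ (∏ (restrict (suc b′) ∘ suc) (s * suc d′) ⊗ ∏ (restrict (suc c′) ∘ suc) (s * suc d′))
      ≈⟨ ≈⇒≈ₜ (⊗-cong (multiples (n%n≡0 (suc d′)) ℕₚ.≤-refl (λ t → trans (go₀ t d′) (cong (_* suc t) (sym d≡))))
           (⊗-cong (multiples (m<n⇒m%n≡m b<d) (ℕₚ.<⇒≤ b<d) (λ t → trans (go₁ t d′ b′) (cong (λ x → x * t + suc b′) (sym d≡))))
                   (multiples (m<n⇒m%n≡m c<d) (ℕₚ.<⇒≤ c<d) (λ t → trans (go₁ t d′ c′) (cong (λ x → x * t + suc c′) (sym d≡)))))) ⟩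
    pochhammer d s ⊗ (factors (suc b′) s ⊗ factors (suc c′) s)
      ≈⟨ ≈⇒≈ₜ (≈-trans (⊗-comm _ _) (⊗-congʳ (⊗-comm _ _))) ⟩
    factors (suc c′) s ⊗ factors (suc b′) s ⊗ pochhammer d s ∎
    where
    open SetoidReasoning (truncSetoid {suc s})
    F-near : ∀ m → F-factor (suc m) ≈[ suc m ] oneₚ
    F-near m = if-≈ₜ-one (not (modN (suc m) 4 ≡ᵇ 2)) (≈ₜ-trans (≈⇒≈ₜ (1-mono (suc m))) (1-q^≈1 ℕₚ.≤-refl))
    G-near : ∀ m → G-factor (suc m) ≈[ suc m ] oneₚ
    G-near m = if-≈ₜ-one (inG k (suc i) (suc m)) (geom≈1 m)
    truncate : ∀ {P} → (∀ m → P (suc m) ≈[ suc m ] oneₚ) → infProd P ≈[ suc s ] ∏ (P ∘ suc) (s * suc d′)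
    truncate {P} h = ≈ₜ-weaken (s≤s (ℕₚ.m≤m*n s (suc d′))) (infProd-∏ {P} h (s * suc d′))
    multiples : ∀ {ρ v} {e : ℕ → ℕ} → suc v % suc d′ ≡ ρ → v < suc d′ → (∀ t → suc (t * suc d′ + v) ≡ e t) →
      ∏ (restrict ρ ∘ suc) (s * suc d′) ≈ ∏ (λ t → oneₚ ⊝ q^ (e t)) s
    multiples {v = v} refl v<d e≡ = ≈-trans (∏-restrict v s v<d)
      (∏-cong s λ t _ → ⊕-congˡ (⊝-cong (q^-cong (e≡ t))))
    go₀ : ∀ t d → suc (t * suc d + d) ≡ suc d * suc t
    go₀ = solve-∀
    go₁ : ∀ t d v → suc (t * suc d + v) ≡ suc d * t + suc v
    go₁ = solve-∀

  summand-θ : ∀ n → summand k 0 i r n ≈ θ (suc b′) n ⊕ θ (suc c′) (suc n)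
  summand-θ n = begin
    summand k 0 i r n
      ≈⟨ ⊗-congˡ (⊕-congʳ (⊕-congˡ (⊝-cong (≈-trans (q^-cong (go₁ r n))
           (≈-trans (q^-+ _ _) (⊗-congˡ (q^-+ _ _))))))) ⟩
    σ n ⊗ (oneₚ ⊗ (oneₚ ⊗ g)) ⊗ q^ E ⊗ ((oneₚ ⊝ V ⊗ (Y ⊗ Y)) ⊕ Y ⊗ (oneₚ ⊝ V))
      ≈⟨ Id.theta-bracket (σ n) (q^ E) g Y V (1+q^-inverse (2 * (n + 0))) ⟩
    σ n ⊗ q^ E ⊕ neg (σ n) ⊗ (q^ E ⊗ (V ⊗ Y))
      ≈⟨ ⊕-cong (⊗-congˡ (q^-cong (go₂ i r n (tri n))))
                (⊗-congˡ (≈-trans (⊗-congˡ (≈-sym (q^-+ _ _))) (≈-trans (≈-sym (q^-+ _ _)) (q^-cong (go₃ i r n (tri n)))))) ⟩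
    θ (suc b′) n ⊕ θ (suc c′) (suc n) ∎
    where
    open SetoidReasoning setoid
    E : ℕ
    E = exponent k 0 i n
    g V Y : PS
    g = 1+q^⁻¹ (2 * (n + 0) + 1)
    V = q^ (2 * r * (2 * n + 0 + 1))
    Y = q^ (2 * (n + 0) + 1)
    go₁ : ∀ r n → 2 * (r + 1) * (2 * n + 0 + 1) ≡ 2 * r * (2 * n + 0 + 1) + (2 * (n + 0) + 1 + (2 * (n + 0) + 1))
    go₁ = solve-∀
    go₂ : ∀ i r n t → 4 * (suc i + r) * t + (2 * (suc i + r) * (0 + 1) + (2 * i + 1)) * n
      ≡ (suc (2 * (suc i + r) + 2 * i) + suc (2 * r)) * t + suc (2 * (suc i + r) + 2 * i) * n
    go₂ = solve-∀
    go₃ : ∀ i r n t → 4 * (suc i + r) * t + (2 * (suc i + r) * (0 + 1) + (2 * i + 1)) * n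
        + (2 * r * (2 * n + 0 + 1) + (2 * (n + 0) + 1))
      ≡ (suc (2 * (suc i + r) + 2 * i) + suc (2 * r)) * (t + n) + suc (2 * r) * suc n
    go₃ = solve-∀

  infSum-θ : ∀ s → infSum (term k 0 (suc i)) ≈[ suc s ] Σ (λ n → θ (suc c′) (suc n)) s ⊕ Σ (θ (suc b′)) (suc s)
  infSum-θ s = begin
    infSum (term k 0 (suc i))
      ≈⟨ infSum-summand 0 i r refl (suc s) ⟩
    Σ (summand k 0 i r) (suc s)
      ≈⟨ ≈⇒≈ₜ (≈-trans (Σ-cong (suc s) λ n _ → summand-θ n) (Σ-⊕ _ _ (suc s))) ⟩
    Σ (θ (suc b′)) (suc s) ⊕ (Σ (λ n → θ (suc c′) (suc n)) s ⊕ θ (suc c′) (suc s))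
      -- The n-th summand brings the `c`-part of index n + 1, so one more of these terms is present
      -- than in `jacobi`; it vanishes modulo q^(s+1).
      ≈⟨ ⊕-congₜ ≈ₜ-refl (≈ₜ-trans (⊕-congₜ ≈ₜ-refl (θ-order c′ (suc s))) (≈⇒≈ₜ (⊕-identityʳ _))) ⟩
    Σ (θ (suc b′)) (suc s) ⊕ Σ (λ n → θ (suc c′) (suc n)) s
      ≈⟨ ≈⇒≈ₜ (⊕-comm _ _) ⟩
    Σ (λ n → θ (suc c′) (suc n)) s ⊕ Σ (θ (suc b′)) (suc s) ∎
    where open SetoidReasoning (truncSetoid {suc s})

  F⊗Gbase≈infSum : F ⊗ Gbase k (suc i) ≈ infSum (term k 0 (suc i))
  F⊗Gbase≈infSum = mk λ n → coeffₜ (≈ₜ-trans (F⊗Gbase n) (≈ₜ-trans (jacobi n) (≈ₜ-sym (infSum-θ n)))) n ℕₚ.≤-refl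

  Gbase≈RHS : Gbase k (suc i) ≈ RHS k 0 (suc i)
  Gbase≈RHS = begin
    Gbase k (suc i)                       ≈⟨ ⊗-identityˡ _ ⟨
    oneₚ ⊗ Gbase k (suc i)                ≈⟨ ⊗-congʳ F-inverse ⟨
    F ⊗ invF ⊗ Gbase k (suc i)            ≈⟨ ≈-trans (⊗-congʳ (⊗-comm _ _)) (⊗-assoc _ _ _) ⟩
    invF ⊗ (F ⊗ Gbase k (suc i))          ≈⟨ ⊗-congˡ F⊗Gbase≈infSum ⟩
    invF ⊗ infSum (term k 0 (suc i))      ≈⟨ *ₚ≈⊗ _ _ ⟨
    RHS k 0 (suc i)                       ∎
    where
    open SetoidReasoning setoid
    F-inverse : F ⊗ invF ≈ oneₚ
    F-inverse = ≈-trans (⊗-congʳ (≈-trans (≈-sym (Id.double-difference oneₚ F)) (⊕-congˡ (⊝-cong (≈-sym (-ₚ≈⊕neg oneₚ F))))))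
      (geom-inverse refl)

-- Laurent series and the indexing of G

toL-cong : ∀ {f g} → f ≈ g → ∀ z → toL f z ≡ toL g z
toL-cong h (+ n) = coeff h n
toL-cong h -[1+ n ] = refl

opaque
  unfolding _⊕_

  toL-⊕ : ∀ f g z → toL (f ⊕ g) z ≡ toL f z ℤ.+ toL g z
  toL-⊕ f g (+ n) = refl
  toL-⊕ f g -[1+ n ] = refl

  toL-⊝ : ∀ f g z → toL (f ⊝ g) z ≡ toL f z ℤ.- toL g z
  toL-⊝ f g (+ n) = refl
  toL-⊝ f g -[1+ n ] = refl

toL-q^-⊗ : ∀ e f z → toL (q^ e ⊗ f) (z ℤ.+ + e) ≡ toL f z
toL-q^-⊗ e f (+ n) = trans (cong (q^ e ⊗ f) (ℕₚ.+-comm n e)) (q^-⊗-shift e f n)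
-- For a negative index the shifted one may be non-negative, but it stays below `e`, where the
-- product has no coefficients.
toL-q^-⊗ e f -[1+ n ] = below (e ℤ.⊖ suc n) (ℤₚ.m⊖1+n<m e (suc n))
  where
  below : ∀ w → w ℤ.< + e → toL (q^ e ⊗ f) w ≡ + 0
  below -[1+ m ] _ = refl
  below (+ m) m<e = coeffₜ (⊗-orderₜˡ f (q^-order e)) m (ℤₚ.drop‿+<+ m<e)

-- The equation of power series cleared of denominators, turned back into the shifted coefficients
-- of `divq`: dividing `q^ a` by q^(a+1) leaves the 1/q in front of `h′`.
toL-recursion : ∀ {f g h h′} a → f ⊝ g ≈ q^ (suc a) ⊗ h ⊕ q^ a ⊗ h′ → ∀ z →
  (toL f (z ℤ.+ + suc a) ℤ.- toL g (z ℤ.+ + suc a)) ℤ.- toL h′ (z ℤ.+ + 1) ≡ toL h z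
toL-recursion {f} {g} {h} {h′} a fg≈ z = begin
  (toL f w ℤ.- toL g w) ℤ.- toL h′ (z ℤ.+ + 1)
    ≡⟨ cong (ℤ._- toL h′ (z ℤ.+ + 1)) (trans (sym (toL-⊝ f g w)) (trans (toL-cong fg≈ w) (toL-⊕ _ _ w))) ⟩
  (toL (q^ (suc a) ⊗ h) w ℤ.+ toL (q^ a ⊗ h′) w) ℤ.- toL h′ (z ℤ.+ + 1)
    ≡⟨ cong₂ (λ x y → (x ℤ.+ y) ℤ.- toL h′ (z ℤ.+ + 1)) (toL-q^-⊗ (suc a) h z)
         (trans (cong (toL (q^ a ⊗ h′)) (sym (ℤₚ.+-assoc z (+ 1) (+ a)))) (toL-q^-⊗ a h′ (z ℤ.+ + 1))) ⟩
  (toL h z ℤ.+ toL h′ (z ℤ.+ + 1)) ℤ.- toL h′ (z ℤ.+ + 1)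
    ≡⟨ ℤₚ.+-assoc (toL h z) _ _ ⟩
  toL h z ℤ.+ (toL h′ (z ℤ.+ + 1) ℤ.- toL h′ (z ℤ.+ + 1))
    ≡⟨ trans (cong (λ x → toL h z ℤ.+ x) (ℤₚ.+-inverseʳ (toL h′ (z ℤ.+ + 1)))) (ℤₚ.+-identityʳ _) ⟩
  toL h z ∎
  where
  open ≡.≡-Reasoning
  w : ℤ
  w = z ℤ.+ + suc a

RHS-step : ∀ i r j {a} → 2 * suc j * suc i ≡ suc a → let k = suc (suc i) + r in
  RHS k j (suc r) ⊝ RHS k j (suc (suc r)) ≈ q^ (suc a) ⊗ RHS k (suc j) (suc (suc i)) ⊕ q^ a ⊗ RHS k (suc j) (suc i)
RHS-step i r j {a} a≡ = begin
  RHS k j (suc r) ⊝ RHS k j (suc (suc r))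
    ≈⟨ ⊕-cong (*ₚ≈⊗ _ _) (⊝-cong (*ₚ≈⊗ _ _)) ⟩
  invF ⊗ infSum (term k j (suc r)) ⊝ invF ⊗ infSum (term k j (suc (suc r)))
    ≈⟨ Id.distribˡ-difference invF _ _ ⟨
  invF ⊗ (infSum (term k j (suc r)) ⊝ infSum (term k j (suc (suc r))))
    ≈⟨ ⊗-congˡ infSum-step ⟩
  invF ⊗ (q^ (suc a) ⊗ infSum (term k (suc j) (suc (suc i))) ⊕ q^ a ⊗ infSum (term k (suc j) (suc i)))
    ≈⟨ Id.distribute-past invF _ _ _ _ ⟩
  q^ (suc a) ⊗ (invF ⊗ infSum (term k (suc j) (suc (suc i)))) ⊕ q^ a ⊗ (invF ⊗ infSum (term k (suc j) (suc i)))
    ≈⟨ ⊕-cong (⊗-congˡ (*ₚ≈⊗ _ _)) (⊗-congˡ (*ₚ≈⊗ _ _)) ⟨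
  q^ (suc a) ⊗ RHS k (suc j) (suc (suc i)) ⊕ q^ a ⊗ RHS k (suc j) (suc i) ∎
  where
  open SetoidReasoning setoid
  open Step i r j a≡

RHS-first : ∀ r j → RHS (suc r) j (suc r) ≈ RHS (suc r) (suc j) 1
RHS-first r j = ≈-trans (*ₚ≈⊗ invF _) (≈-trans (⊗-congˡ (FirstStep.infSum-first r j)) (≈-sym (*ₚ≈⊗ invF _)))

-- `k` stays a variable tied to `i` and `r` by an equation, because the calls to the preceding shelf
-- use other decompositions of the same `k`. Since the right-hand side comes from a power series,
-- the claim includes that negative powers cancel in the recursion.
shelf-RHS : ∀ j i r k → k ≡ suc i + r → ∀ z → shelf k j (suc i) z ≡ toL (RHS k j (suc i)) z
shelf-RHS zero i r k refl z = toL-cong (Base.Gbase≈RHS i r) z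
shelf-RHS (suc j) zero r k refl z =
  trans (shelf-RHS j r 0 k (sym (ℕₚ.+-identityʳ (suc r))) z) (toL-cong (RHS-first r j) z)
shelf-RHS (suc j) (suc i) r k refl z = trans
  (cong₂ ℤ._-_
    (cong₂ ℤ._-_ (previous (r≡ 1) (shelf-RHS j r (suc i) k (go₁ i r) w))
                 (previous (r≡ 2) (shelf-RHS j (suc r) i k (go₂ i r) w)))
    (shelf-RHS (suc j) i (suc r) k (cong suc (sym (ℕₚ.+-suc i r))) (z ℤ.+ + 1)))
  (toL-recursion _ (RHS-step i r j refl) z)
  where
  w : ℤ
  w = z ℤ.+ + (2 * suc j * suc i)
  r≡ : ∀ x → i + r ∸ i + x ≡ x + r
  r≡ x = trans (cong (_+ x) (ℕₚ.m+n∸m≡n i r)) (ℕₚ.+-comm r x)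
  previous : ∀ {m n x} → m ≡ n → shelf k j n w ≡ x → shelf k j m w ≡ x
  previous refl h = h
  go₁ : ∀ i r → suc (suc i) + r ≡ suc r + suc i
  go₁ = solve-∀
  go₂ : ∀ i r → suc (suc i) + r ≡ suc (suc r) + i
  go₂ = solve-∀

-- Locating an index on its shelf

G-low : ∀ {k l} → l ≤ k → G k l ≡ shelf k 0 l
G-low {k} {l} l≤k with l ≤ᵇ k in eq
... | true = refl
... | false = contradiction (ℕₚ.≤⇒≤ᵇ l≤k) (subst (λ b → ¬ T b) (sym eq) λ ())

G-high : ∀ {k l} → k < l → G k l ≡ shelf k (divN (l ∸ 2) (k ∸ 1)) (modN (l ∸ 2) (k ∸ 1) + 2)
G-high {k} {l} k<l with l ≤ᵇ k in eq
... | false = refl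
... | true = contradiction (ℕₚ.≤ᵇ⇒≤ l k (subst T (sym eq) _)) (ℕₚ.<⇒≱ k<l)

-- Beyond the initial shelf `G` decodes its index only to the positions 2, ..., k of a shelf.
-- Position 1 is therefore rewritten as the last position of the preceding shelf, which the other
-- cases cover.
G-shelf : ∀ k j i → suc i ≤ suc (suc k) → G (suc (suc k)) (suc k * j + suc i) ≡ shelf (suc (suc k)) j (suc i)
G-shelf k zero i 1+i≤k rewrite ℕₚ.*-zeroʳ (suc k) = G-low 1+i≤k
G-shelf k (suc j) zero _ = trans (cong (G (suc (suc k))) (go k j)) (G-shelf k j (suc k) ℕₚ.≤-refl)
  where
  go : ∀ k j → suc k * suc j + 1 ≡ suc k * j + suc (suc k)
  go = solve-∀
G-shelf k (suc j) (suc i) (s≤s i<1+k) = trans (G-high large) (cong₂ (shelf (suc (suc k))) quotient remainder)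
  where
  l : ℕ
  l = suc k * suc j + suc (suc i)
  large : suc (suc k) < l
  large = ℕₚ.≤-trans (ℕₚ.m≤m+n (3 + k) (suc k * j + i)) (ℕₚ.≤-reflexive (go k j i))
    where
    go : ∀ k j i → 3 + k + (suc k * j + i) ≡ suc k * suc j + suc (suc i)
    go = solve-∀
  l∸2 : l ∸ 2 ≡ i + suc j * suc k
  l∸2 = cong (_∸ 2) (go k j i)
    where
    go : ∀ k j i → suc k * suc j + suc (suc i) ≡ 2 + (i + suc j * suc k)
    go = solve-∀
  quotient : (l ∸ 2) / suc k ≡ suc j
  quotient = trans (cong (_/ suc k) l∸2) (trans (+-distrib-/-∣ʳ i (divides (suc j) refl))
    (cong₂ _+_ (m<n⇒m/n≡0 i<1+k) (m*n/n≡m (suc j) (suc k))))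
  remainder : (l ∸ 2) % suc k + 2 ≡ suc (suc i)
  remainder = trans (cong (_+ 2) (trans (cong (_% suc k) l∸2) (trans ([m+kn]%n≡m%n i (suc j) (suc k)) (m<n⇒m%n≡m i<1+k))))
    (ℕₚ.+-comm i 2)

theorem3p1 : (k : ℕ) → 2 ≤ k → (j i : ℕ) → 1 ≤ i → i ≤ k →
    (z : ℤ) → G k ((k ∸ 1) * j + i) z ≡ toL (RHS k j i) z
theorem3p1 (suc (suc k)) (s≤s (s≤s z≤n)) j (suc i) (s≤s z≤n) i<k z =
  trans (cong (λ f → f z) (G-shelf k j i i<k))
        (shelf-RHS j i (suc (suc k) ∸ suc i) (suc (suc k)) (sym (ℕₚ.m+[n∸m]≡n i<k)) z)
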